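{- Let $k\ge1$, $m\ge1$, let $1\le t_1,\dots,t_m\le k$ be distinct integers, $a_1,\dots,a_m$ positive integers, $P=R_{t_1}^{a_1}\cup\cdots\cup R_{t_m}^{a_m}$, and for $u\in\mathbb Z_{>0}$ let $\alpha_u=\#\{v:1\le v\le m,\ t_v\ge u\}$. Then for $1\le r\le k$, $$\frac{g^{(k)}_{P\cup(r)}}{g^{(k)}_P}=\sum_{s=0}^{r}\binom{\alpha_r+r-s-1}{r-s}h_s .$$ In particular, if $\max_i t_i<r$ (so $\alpha_r=0$), then $g^{(k)}_{P\cup(r)}/g^{(k)}_P=h_r=g^{(k)}_{(r)}$; and for a single $k$-rectangle $R_t$ ($1\le t\le k$), $$\frac{g^{(k)}_{R_t\cup(r)}}{g^{(k)}_{R_t}}=\begin{cases}h_r & \text{if } r>t,\\ h_r+h_{r-1}+\cdots+h_0 & \text{if } r\le t.\end{cases}$$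
   Context: Partitions are identified with Young diagrams in French notation (cells $(i,j)$ with $j\le\lambda_i$, row $i$ from the bottom); $\lambda'$ is the conjugate; $\lambda\cup\mu$ is the partition whose multiset of parts is the union of those of $\lambda$ and $\mu$; $(r)$ is the one-part partition. $\mathcal P^k$ is the set of partitions with $\lambda_1\le k$. For $1\le t\le k$, $R_t=(t^{k+1-t})$ and $R_t^a$ is the union of $a$ copies of $R_t$. The hook length of $c=(i,j)\in\lambda$ is $\lambda_i+\lambda'_j-i-j+1$. A $(k+1)$-core has no cell of hook length $k+1$; $|\kappa|_{k+1}$ is its number of cells of hook length $<k+1$. The map $\mathfrak p(\kappa)_i=\#\{j:(i,j)\in\kappa,\ \text{hook length}\le k\}$ is a bijection from $(k+1)$-cores to $\mathcal P^k$ with inverse $\mathfrak c$. The residue of $(i,j)$ is $j-i\bmod(k+1)$. For $(k+1)$-cores $\tau\subset\kappa$, $\kappa/\tau$ is a weak $r$-strip if it is a horizontal strip, $|\kappa|_{k+1}=|\tau|_{k+1}+r$, and its cells have exactly $r$ distinct residues. A removable corner of $\mu$ is $(i,j)\in\mu$ with $(i+1,j),(i,j+1)\notin\mu$; $(i,j)$ is $\lambda$-blocked if $(i+1,j)\in\lambda$; $r_{\lambda\mu}$ is the number of distinct residues of non-$\lambda$-blocked removable corners of $\mu$. $h_r$ are the complete homogeneous symmetric functions ($h_0=1$), $\Lambda^{(k)}=\mathbb Z[h_1,\dots,h_k]$. $\binom ab=a(a-1)\cdots(a-b+1)/b!$ for $a\in\mathbb Z$, $b\ge0$ (so $\binom{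 -1}{0}=1$), and $0$ for $b<0$. The $K$-$k$-Schur functions $\{g^{(k)}_\lambda\}_{\lambda\in\mathcal P^k}$ are the unique elements of $\Lambda^{(k)}$ with $g^{(k)}_\emptyset=1$ and, for $\lambda\in\mathcal P^k$, $0\le r\le k$, $$h_r\,g^{(k)}_\lambda=\sum_{s=0}^{r}(-1)^{r-s}\sum_{\mu\in\mathcal P^k:\ \mathfrak c(\mu)/\mathfrak c(\lambda)\text{ weak }s\text{ -strip}}\binom{r_{\mathfrak c(\mu)\mathfrak c(\lambda)}}{r-s}g^{(k)}_\mu .$$ They form a $\mathbb Z$-basis of $\Lambda^{(k)}$, $g^{(k)}_{(r)}=h_r$ for $1\le r\le k$, and $g^{(k)}_P$ divides $g^{(k)}_{P\cup\lambda}$ in $\Lambda^{(k)}$; the quotient denotes the element $q\in\Lambda^{(k)}$ with $g^{(k)}_{P\cup(r)}=g^{(k)}_Pq$. -}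

module Defs where

open import Data.Nat as ℕ using (ℕ; zero; suc; _+_; _*_; _∸_; _%_; _≡ᵇ_; _≤ᵇ_; _<ᵇ_; _!)
open import Data.Nat.Properties using (_!≢0)
open import Data.Integer as ℤ using (ℤ; +_; 0ℤ; 1ℤ; -1ℤ)
open import Data.Integer.DivMod using (_/ℕ_)
open import Data.Bool using (Bool; true; false; _∧_; not; if_then_else_)
open import Data.List using (List; []; _∷_; _++_; [_]; map; concatMap; filterᵇ;
  length; applyUpTo; foldr; deduplicate; zipWith)
open import Data.Vec as Vec using (Vec; tabulate; replicate)
open import Data.Vec.Properties using (≡-dec)
open import Data.Fin as Fin using (Fin; toℕ)
open import Data.Product using (_×_; _,_)
open import Relation.Nullary.Decidable using (⌊_⌋)
open import Relation.Binary.PropositionalEquality using (_≡_)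

all : {A : Set} → (A → Bool) → List A → Bool
all p []       = true
all p (x ∷ xs) = p x ∧ all p xs

-- Partitions: lists of parts λ₁ ≥ λ₂ ≥ … > 0 (row 1 = bottom row, French).

-- λ_i (1-indexed), 0 beyond the length
row : List ℕ → ℕ → ℕ
row []       _             = 0
row (x ∷ xs) zero          = 0
row (x ∷ xs) (suc zero)    = x
row (x ∷ xs) (suc (suc i)) = row xs (suc i)

conj : List ℕ → ℕ → ℕ
conj κ j = length (filterᵇ (λ x → j ≤ᵇ x) κ)

memᵇ : List ℕ → ℕ → ℕ → Bool
memᵇ κ i j = (1 ≤ᵇ i) ∧ (1 ≤ᵇ j) ∧ (j ≤ᵇ row κ i)

upto1 : ℕ → List ℕ
upto1 n = applyUpTo suc n

cellsFrom : ℕ → List ℕ → List (ℕ × ℕ)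
cellsFrom i []       = []
cellsFrom i (x ∷ xs) = map (λ j → (i , j)) (upto1 x) ++ cellsFrom (suc i) xs

cells : List ℕ → List (ℕ × ℕ)
cells κ = cellsFrom 1 κ

hook : List ℕ → ℕ → ℕ → ℕ
hook κ i j = (row κ i + conj κ j + 1) ∸ (i + j)

decreasingᵇ : List ℕ → Bool
decreasingᵇ []           = true
decreasingᵇ (x ∷ [])     = true
decreasingᵇ (x ∷ y ∷ xs) = (y ≤ᵇ x) ∧ decreasingᵇ (y ∷ xs)

isPartitionᵇ : List ℕ → Bool
isPartitionᵇ κ = decreasingᵇ κ ∧ all (λ x → 0 <ᵇ x) κ

ins : ℕ → List ℕ → List ℕ
ins x []       = x ∷ []
ins x (y ∷ ys) = if y <ᵇ x then x ∷ y ∷ ys else y ∷ ins x ys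

sortDesc : List ℕ → List ℕ
sortDesc = foldr ins []

_∪ₚ_ : List ℕ → List ℕ → List ℕ
λ₁ ∪ₚ μ = sortDesc (λ₁ ++ μ)

isCoreᵇ : ℕ → List ℕ → Bool
isCoreᵇ k κ = all (λ { (i , j) → not (hook κ i j ≡ᵇ suc k) }) (cells κ)

size< : ℕ → List ℕ → ℕ
size< k κ = length (filterᵇ (λ { (i , j) → hook κ i j ≤ᵇ k }) (cells κ))

-- the bijection 𝔭 : (k+1)-cores → 𝒫^k ; 𝔭(κ)_i = #{j : (i,j) ∈ κ, hook ≤ k}
pRows : ℕ → List ℕ → ℕ → List ℕ → List ℕ
pRows k κ i []       = []
pRows k κ i (x ∷ xs) =
  length (filterᵇ (λ j → hook κ i j ≤ᵇ k) (upto1 x)) ∷ pRows k κ (suc i) xs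

𝔭 : ℕ → List ℕ → List ℕ
𝔭 k κ = filterᵇ (λ x → 0 <ᵇ x) (pRows k κ 1 κ)

-- residue of (i,j) : j − i mod (k+1)   (computed as (j + k·i) mod (k+1))
residue : ℕ → ℕ × ℕ → ℕ
residue k (i , j) = (j + k * i) % suc k

#distinct : List ℕ → ℕ
#distinct xs = length (deduplicate ℕ._≟_ xs)

containedᵇ : List ℕ → List ℕ → Bool
containedᵇ τ κ = all (λ i → row τ i ≤ᵇ row κ i) (upto1 (length τ))

horizontalᵇ : List ℕ → List ℕ → Bool
horizontalᵇ τ κ = containedᵇ τ κ ∧ all (λ i → row κ (suc i) ≤ᵇ row τ i) (upto1 (length κ))

skewCells : List ℕ → List ℕ → List (ℕ × ℕ)
skewCells κ τ = filterᵇ (λ { (i , j) → not (memᵇ τ i j) }) (cells κ)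

weakStripᵇ : ℕ → List ℕ → List ℕ → ℕ → Bool
weakStripᵇ k τ κ s =
  isPartitionᵇ τ ∧ isCoreᵇ k τ ∧ isPartitionᵇ κ ∧ isCoreᵇ k κ ∧
  horizontalᵇ τ κ ∧ (size< k κ ≡ᵇ size< k τ + s) ∧
  (#distinct (map (residue k) (skewCells κ τ)) ≡ᵇ s)

removableCorners : List ℕ → List (ℕ × ℕ)
removableCorners μ =
  filterᵇ (λ { (i , j) → not (memᵇ μ (suc i) j) ∧ not (memᵇ μ i (suc j)) }) (cells μ)

rBlock : ℕ → List ℕ → List ℕ → ℕ
rBlock k λ₁ μ =
  #distinct (map (residue k)
    (filterᵇ (λ { (i , j) → not (memᵇ λ₁ (suc i) j) }) (removableCorners μ)))

-- Finite candidate list containing every κ with κ/τ a weak s-strip: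
-- κ has at most length τ + 1 rows and τ_i ≤ κ_i ≤ τ_i + s (a row of κ/τ
-- is a run of consecutive cells, which has min(length, k+1) residues ≤ s).
choices : ℕ → List ℕ → List (List ℕ)
choices s []       = [] ∷ []
choices s (x ∷ xs) = concatMap (λ y → map (y ∷_) (choices s xs)) (applyUpTo (λ y → x + y) (suc s))

candidates : List ℕ → ℕ → List (List ℕ)
candidates τ s = map (filterᵇ (λ x → 0 <ᵇ x)) (choices s (τ ++ [ 0 ]))

-- all (k+1)-cores κ with κ/τ a weak s-strip (each exactly once)
strips : ℕ → List ℕ → ℕ → List (List ℕ)
strips k τ s = filterᵇ (λ κ → weakStripᵇ k τ κ s) (candidates τ s)

falling : ℤ → ℕ → ℤ
falling a zero    = 1ℤ
falling a (suc b) = falling a b ℤ.* (a ℤ.- + b)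

binomℤ : ℤ → ℕ → ℤ
binomℤ a b = (falling a b /ℕ (b !)) {{b !≢0}}

sgn : ℕ → ℤ
sgn zero    = 1ℤ
sgn (suc n) = -1ℤ ℤ.* sgn n

-- Λ^(k) = ℤ[h₁,…,h_k] (h₁,…,h_k algebraically independent), modelled as
-- the polynomial ring ℤ[x₁,…,x_k] with x_i standing for h_i.
-- A polynomial is a finite list of terms (coefficient , exponent vector);
-- equality is equality of all coefficients.

Poly : ℕ → Set
Poly k = List (ℤ × Vec ℕ k)

coeff : ∀ {k} → Poly k → Vec ℕ k → ℤ
coeff []             e = 0ℤ
coeff ((c , f) ∷ p)  e = (if ⌊ ≡-dec ℕ._≟_ f e ⌋ then c else 0ℤ) ℤ.+ coeff p e

infix 4 _≈ᴾ_
_≈ᴾ_ : ∀ {k} → Poly k → Poly k → Set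
p ≈ᴾ q = ∀ e → coeff p e ≡ coeff q e

0ᴾ : ∀ {k} → Poly k
0ᴾ = []

1ᴾ : ∀ {k} → Poly k
1ᴾ {k} = (1ℤ , replicate k 0) ∷ []

infixl 6 _+ᴾ_
_+ᴾ_ : ∀ {k} → Poly k → Poly k → Poly k
p +ᴾ q = p ++ q

infixl 7 _*ᴾ_
_*ᴾ_ : ∀ {k} → Poly k → Poly k → Poly k
p *ᴾ q = concatMap (λ { (c , e) → map (λ { (d , f) → (c ℤ.* d , Vec.zipWith _+_ e f) }) q }) p

infixl 7 _·ᴾ_
_·ᴾ_ : ∀ {k} → ℤ → Poly k → Poly k
z ·ᴾ p = map (λ { (c , e) → (z ℤ.* c , e) }) p

Σᴾ : ∀ {k} {A : Set} → List A → (A → Poly k) → Poly k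
Σᴾ xs f = foldr (λ x acc → f x +ᴾ acc) 0ᴾ xs

-- h_r ∈ Λ^(k) : h₀ = 1, h_r = x_r for 1 ≤ r ≤ k (and 0 for r > k, never used)
h : (k : ℕ) → ℕ → Poly k
h k zero    = 1ᴾ
h k (suc r) = if suc r ≤ᵇ k
  then (1ℤ , tabulate (λ (j : Fin k) → if suc (toℕ j) ≡ᵇ suc r then 1 else 0)) ∷ []
  else 0ᴾ

upto0 : ℕ → List ℕ
upto0 n = applyUpTo (λ i → i) (suc n)

-- The defining properties of the K-k-Schur functions {g^(k)_λ}.
-- The family is indexed by partitions; λ ∈ 𝒫^k is written λ = 𝔭(τ) with
-- τ = 𝔠(λ) ranging over (k+1)-cores, and μ = 𝔭(κ) with κ = 𝔠(μ).

PieriRHS : (k : ℕ) → (List ℕ → Poly k) → List ℕ → ℕ → Poly k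
PieriRHS k g τ r =
  Σᴾ (upto0 r) (λ s →
    sgn (r ∸ s) ·ᴾ
      Σᴾ (strips k τ s) (λ κ → binomℤ (+ rBlock k κ τ) (r ∸ s) ·ᴾ g (𝔭 k κ)))

record IsKkSchur (k : ℕ) (g : List ℕ → Poly k) : Set where
  field
    g-empty : g [] ≈ᴾ 1ᴾ
    pieri   : ∀ τ → isPartitionᵇ τ ≡ true → isCoreᵇ k τ ≡ true →
              ∀ r → r ℕ.≤ k → h k r *ᴾ g (𝔭 k τ) ≈ᴾ PieriRHS k g τ r

Rect : ℕ → ℕ → List ℕ
Rect k t = Data.List.replicate (suc k ∸ t) t

RectPow : ℕ → ℕ → ℕ → List ℕ
RectPow k t zero    = []
RectPow k t (suc a) = Rect k t ∪ₚ RectPow k t a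

Pfam : (k m : ℕ) → (Fin m → ℕ) → (Fin m → ℕ) → List ℕ
Pfam k m t a = foldr (λ v acc → RectPow k (t v) (a v) ∪ₚ acc) [] (Data.List.allFin m)

α : (m : ℕ) → (Fin m → ℕ) → ℕ → ℕ
α m t u = length (filterᵇ (λ v → u ≤ᵇ t v) (Data.List.allFin m))

quotientRHS : (k m : ℕ) → (Fin m → ℕ) → ℕ → Poly k
quotientRHS k m t r =
  Σᴾ (upto0 r) (λ s → binomℤ ((+ α m t r ℤ.+ + (r ∸ s)) ℤ.- 1ℤ) (r ∸ s) ·ᴾ h k s)

{-# OPTIONS --safe #-}
module Submission where

-- Write the blocks of P with the tallest rectangle on top. The core of P is the staircase of
-- these rectangles, and all its addable corners have the same residue, so for each s ≤ k there
-- is only one weak s-strip on it: the bottom row gets s cells and every other addable row as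
-- many of them as fit, which is the core of P ∪ (s). An R_t-corner stays unblocked exactly when s < t,
-- and corners of rectangles with different t have different residues. Hence the Pieri rule reads
--   h_r g_P = Σ_s (-1)^(r-s) C(α_{s+1}, r-s) g_{P∪(s)},
-- a triangular system for the g_{P∪(s)}. Since α drops by at most one at each step, the
-- coefficients of (1 - x)^(-β) Σ h_s x^s with β = α_r solve it, by summation by parts.

open import Defs
open import Data.Bool using (Bool; true; false; T; _∧_; not; if_then_else_)
open import Data.Bool.Properties using (T-≡)
open import Data.Empty using (⊥-elim)
open import Data.Fin using (Fin)
open import Data.Integer as ℤ using (ℤ; +_; 0ℤ; 1ℤ; -1ℤ)
import Data.Integer.Properties as ℤₚ
import Data.Integer.Tactic.RingSolver as ℤ-Ring
open import Algebra.Properties.AbelianGroup ℤₚ.+-0-abelianGroup using () renaming (∙-cancelˡ to ℤ-+-cancelˡ)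
open import Data.List
  using (List; []; _∷_; _++_; [_]; map; concatMap; cartesianProductWith; foldr; length; filterᵇ; replicate; applyUpTo; allFin)
open import Data.List.Properties
  using (length-map; length-++; length-applyUpTo; applyUpTo-∷ʳ; ++-assoc; filter-++; filter-all; filter-none; concatMap-++)
open import Data.List.Membership.Propositional using (_∈_)
open import Data.List.Membership.Propositional.Properties
  using (∈-++⁺ˡ; ∈-++⁺ʳ; ∈-++⁻; ∈-map⁺; ∈-map⁻; ∈-filter⁺; ∈-filter⁻; ∈-applyUpTo⁺; ∈-applyUpTo⁻; ∈-allFin;
         ∈-concatMap⁺; ∈-concatMap⁻; ∈-cartesianProductWith⁺; ∈-cartesianProductWith⁻; deduplicate-∈⇔)
open import Data.List.Membership.Propositional.Properties.WithK using (unique∧set⇒bag)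
open import Data.List.Relation.Binary.BagAndSetEquality using (∼bag⇒↭)
open import Data.List.Relation.Binary.Permutation.Propositional as Perm
  using (_↭_; ↭-refl; ↭-sym; ↭-trans; ↭-reflexive; prep; module PermutationReasoning)
open import Data.List.Relation.Binary.Permutation.Propositional.Properties
  using (↭-length; drop-∷; ∷↭∷ʳ; All-resp-↭; ∈-resp-↭; ↭-empty-inv; ++⁺ˡ; shifts) renaming (++⁺ to ↭-++⁺)
open import Data.List.Relation.Binary.Pointwise using (Pointwise; []; _∷_)
open import Data.List.Relation.Unary.All as All using (All; []; _∷_)
open import Data.List.Relation.Unary.All.Properties as Allₚ using (++⁺; ++⁻ˡ; replicate⁺)
open import Data.List.Relation.Unary.AllPairs using (AllPairs; []; _∷_)
open import Data.List.Relation.Unary.Any as Any using (here; there; satisfied)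
open import Data.List.Relation.Unary.Unique.Propositional using (Unique)
open import Data.List.Relation.Unary.Unique.Propositional.Properties
  using (cartesianProductWith⁺; applyUpTo⁺₁; map⁺; filter⁺; allFin⁺)
open import Data.Nat as ℕ
  using (ℕ; zero; suc; _+_; _*_; _∸_; _⊓_; _⊔_; _%_; _!; z≤n; s≤s; _≤_; _<_; _≥_; _≤ᵇ_; _<ᵇ_; _≡ᵇ_; _≤?_; _<?_; _≟_; NonZero)
open import Data.Nat.Combinatorics using (_C_; k>n⇒nCk≡0; nCk+nC[k+1]≡[n+1]C[k+1])
open import Data.Nat.DivMod using (m*n/n≡m; %-distribˡ-+; m<n⇒m%n≡m; m≤n⇒[n∸m]%m≡n%m; [m+kn]%n≡m%n; m%n<n)
open import Data.Nat.Induction using (<-rec)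
open import Data.Nat.ListAction using (sum)
open import Data.Nat.ListAction.Properties using (sum-++)
open import Data.Nat.Properties
open import Data.Nat.Tactic.RingSolver using (solve-∀)
open import Data.List.Relation.Unary.Unique.DecPropositional.Properties _≟_ using (deduplicate-!)
open import Data.Product using (_×_; _,_; ∃; ∃₂; proj₁; proj₂)
open import Data.Sum using (_⊎_; inj₁; inj₂)
open import Data.Vec.Properties using (≡-dec; zipWith-comm)
open import Function using (id; _∘_; mk⇔)
open import Function.Bundles using (Equivalence)
open import Relation.Binary using (tri<; tri≈; tri>)
open import Relation.Binary.PropositionalEquality hiding ([_])
open import Relation.Nullary using (Dec; yes; no; contradiction)
open import Relation.Nullary.Decidable using (⌊_⌋; T?; dec-true; dec-false)

-- Binomial coefficients and the triangular system

-- One number e drives the combinatorics: how far the bottom row of a block sticks out beyond the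
-- core of P. A block R_t passes e ⊓ t on to the blocks above it, since a row overhanging by more
-- than t would pass the end of that block. The same exchange of e and t for e ⊔ t and e ⊓ t inserts
-- the part e into the sorted list P, so `core` and `partition` run through the blocks in parallel.
-- Hook lengths do not suit such an induction. `CoreRows` trades them for a recursion on rows, which
-- characterises cores and delivers 𝔭 and |κ|_{k+1} at the same time. Addable corners share their
-- residue because climbing over R_t means k + 1 - t rows up and t columns left, which changes j - i
-- by -(k + 1). Uniqueness of the strip is a count: a horizontal strip with e cells in the bottom
-- row that ends in a core gains at most e cells of small hook, and gains e only if every block
-- passes on all that fits.

falling-suc : ∀ a b → falling (1ℤ ℤ.+ a) (suc b) ≡ (1ℤ ℤ.+ a) ℤ.* falling a b
falling-suc a zero = lemma a
  where
  lemma : ∀ a → 1ℤ ℤ.* ((1ℤ ℤ.+ a) ℤ.- 0ℤ) ≡ (1ℤ ℤ.+ a) ℤ.* 1ℤ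
  lemma = ℤ-Ring.solve-∀
falling-suc a (suc b) = begin
  falling (1ℤ ℤ.+ a) (suc b) ℤ.* ((1ℤ ℤ.+ a) ℤ.- + suc b)
    ≡⟨ cong (ℤ._* ((1ℤ ℤ.+ a) ℤ.- + suc b)) (falling-suc a b) ⟩
  ((1ℤ ℤ.+ a) ℤ.* falling a b) ℤ.* ((1ℤ ℤ.+ a) ℤ.- (1ℤ ℤ.+ + b))
    ≡⟨ lemma a (falling a b) (+ b) ⟩
  (1ℤ ℤ.+ a) ℤ.* (falling a b ℤ.* (a ℤ.- + b)) ∎
  where
  open ≡-Reasoning
  lemma : ∀ a f b → ((1ℤ ℤ.+ a) ℤ.* f) ℤ.* ((1ℤ ℤ.+ a) ℤ.- (1ℤ ℤ.+ b)) ≡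
                    (1ℤ ℤ.+ a) ℤ.* (f ℤ.* (a ℤ.- b))
  lemma = ℤ-Ring.solve-∀

falling-C : ∀ n b → falling (+ n) b ≡ + (n C b) ℤ.* + (b !)
falling-C n zero = refl
-- With 0 = 1 + (-1), the factor split off in front is 0.
falling-C zero (suc b) = falling-suc -1ℤ b
falling-C (suc n) (suc b) = begin
  falling (+ suc n) (suc b)            ≡⟨ falling-suc (+ n) b ⟩
  (1ℤ ℤ.+ + n) ℤ.* falling (+ n) b     ≡⟨ split (+ n) (+ b) (falling (+ n) b) ⟩
  (1ℤ ℤ.+ + b) ℤ.* falling (+ n) b ℤ.+ falling (+ n) (suc b)
    ≡⟨ cong₂ (λ x y → (1ℤ ℤ.+ + b) ℤ.* x ℤ.+ y) (falling-C n b) (falling-C n (suc b)) ⟩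
  (1ℤ ℤ.+ + b) ℤ.* (+ (n C b) ℤ.* + (b !)) ℤ.+ + (n C suc b) ℤ.* + (suc b !)
    ≡⟨ cong (λ z → (1ℤ ℤ.+ + b) ℤ.* (+ (n C b) ℤ.* + (b !)) ℤ.+ + (n C suc b) ℤ.* z) (ℤₚ.pos-* (suc b) (b !)) ⟩
  (1ℤ ℤ.+ + b) ℤ.* (+ (n C b) ℤ.* + (b !)) ℤ.+ + (n C suc b) ℤ.* ((1ℤ ℤ.+ + b) ℤ.* + (b !))
    ≡⟨ merge (+ b) (+ (n C b)) (+ (b !)) (+ (n C suc b)) ⟩
  (+ (n C b) ℤ.+ + (n C suc b)) ℤ.* ((1ℤ ℤ.+ + b) ℤ.* + (b !))
    ≡⟨ cong₂ ℤ._*_ (cong +_ (nCk+nC[k+1]≡[n+1]C[k+1] n b)) (sym (ℤₚ.pos-* (suc b) (b !))) ⟩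
  + (suc n C suc b) ℤ.* + (suc b !) ∎
  where
  open ≡-Reasoning
  split : ∀ n b f → (1ℤ ℤ.+ n) ℤ.* f ≡ (1ℤ ℤ.+ b) ℤ.* f ℤ.+ f ℤ.* (n ℤ.- b)
  split = ℤ-Ring.solve-∀
  merge : ∀ b x f y → (1ℤ ℤ.+ b) ℤ.* (x ℤ.* f) ℤ.+ y ℤ.* ((1ℤ ℤ.+ b) ℤ.* f) ≡
                      (x ℤ.+ y) ℤ.* ((1ℤ ℤ.+ b) ℤ.* f)
  merge = ℤ-Ring.solve-∀

binomℤ-C : ∀ n b → binomℤ (+ n) b ≡ + (n C b)
binomℤ-C n b
  rewrite falling-C n b
        | sym (ℤₚ.pos-* (n C b) (b !))
  = cong +_ (m*n/n≡m (n C b) (b !) {{_!≢0 b}})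

-- β multichoose j, the coefficient of xʲ in (1 - x)^(-β)
multichoose : ℕ → ℕ → ℕ
multichoose _       zero    = 1
multichoose zero    (suc j) = 0
multichoose (suc β) (suc j) = multichoose (suc β) j + multichoose β (suc j)

multichoose-C : ∀ β j → multichoose β (suc j) ≡ (β + j) C suc j
multichoose-C zero    j = sym (k>n⇒nCk≡0 (n<1+n j))
multichoose-C (suc β) zero
  rewrite multichoose-C β zero = nCk+nC[k+1]≡[n+1]C[k+1] (β + 0) 0
multichoose-C (suc β) (suc j)
  rewrite multichoose-C (suc β) j | multichoose-C β (suc j) | +-suc β j
  = nCk+nC[k+1]≡[n+1]C[k+1] (suc (β + j)) (suc j)

-- Only for j = 0 can the upper entry be negative, namely -1 when β = 0, and there both sides are 1.
-- Otherwise it is the natural number β + (j - 1).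
binomℤ-multichoose : ∀ β j → binomℤ ((+ β ℤ.+ + j) ℤ.- 1ℤ) j ≡ + multichoose β j
binomℤ-multichoose β zero    = refl
binomℤ-multichoose β (suc j)
  rewrite +-suc β j | multichoose-C β j = binomℤ-C (β + j) (suc j)

Σ≤ : ℕ → (ℕ → ℤ) → ℤ
Σ≤ zero    f = f 0
Σ≤ (suc n) f = Σ≤ n f ℤ.+ f (suc n)

Σ≤-cong : ∀ n {f g} → (∀ i → i ≤ n → f i ≡ g i) → Σ≤ n f ≡ Σ≤ n g
Σ≤-cong zero    eq = eq 0 z≤n
Σ≤-cong (suc n) eq = cong₂ ℤ._+_ (Σ≤-cong n (λ i i≤n → eq i (m≤n⇒m≤1+n i≤n))) (eq (suc n) ≤-refl)

Σ≤-+ : ∀ n f g → Σ≤ n (λ i → f i ℤ.+ g i) ≡ Σ≤ n f ℤ.+ Σ≤ n g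
Σ≤-+ zero    f g = refl
Σ≤-+ (suc n) f g rewrite Σ≤-+ n f g = lemma (Σ≤ n f) (Σ≤ n g) (f (suc n)) (g (suc n))
  where
  lemma : ∀ a b c d → (a ℤ.+ b) ℤ.+ (c ℤ.+ d) ≡ (a ℤ.+ c) ℤ.+ (b ℤ.+ d)
  lemma = ℤ-Ring.solve-∀

Σ≤-front : ∀ n f → f 0 ℤ.+ Σ≤ n (λ i → f (suc i)) ≡ Σ≤ (suc n) f
Σ≤-front zero    f = refl
Σ≤-front (suc n) f rewrite sym (Σ≤-front n f) = sym (ℤₚ.+-assoc (f 0) _ _)

-- Abel summation, with `B` the partial sums of `B′`. The boundary term is kept because
-- `weight-lower` matches it with half of a mixed term.
Σ≤-by-parts : ∀ n (w B B′ : ℕ → ℤ) → B 0 ≡ B′ 0 → (∀ i → i < n → B (suc i) ≡ B i ℤ.+ B′ (suc i)) →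
  Σ≤ n (λ i → w i ℤ.* B′ i) ≡
  Σ≤ n (λ i → (w i ℤ.- w (suc i)) ℤ.* B i) ℤ.+ w (suc n) ℤ.* B n
Σ≤-by-parts zero w B B′ B₀ _ rewrite B₀ = lemma (w 0) (w 1) (B′ 0)
  where
  lemma : ∀ x y b → x ℤ.* b ≡ (x ℤ.- y) ℤ.* b ℤ.+ y ℤ.* b
  lemma = ℤ-Ring.solve-∀
Σ≤-by-parts (suc n) w B B′ B₀ step
  rewrite Σ≤-by-parts n w B B′ B₀ (λ i i<n → step i (m<n⇒m<1+n i<n))
        | step n (n<1+n n)
  = lemma (Σ≤ n (λ i → (w i ℤ.- w (suc i)) ℤ.* B i)) (w (suc n)) (w (suc (suc n))) (B n) (B′ (suc n))
  where
  lemma : ∀ S x y b c → S ℤ.+ x ℤ.* b ℤ.+ x ℤ.* c ≡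
                        S ℤ.+ (x ℤ.- y) ℤ.* (b ℤ.+ c) ℤ.+ y ℤ.* (b ℤ.+ c)
  lemma = ℤ-Ring.solve-∀

module Inversion (H : ℕ → ℤ) where

  -- B β r is the coefficient of xʳ in (1 - x)^(-β) Σₛ H s xˢ
  B : ℕ → ℕ → ℤ
  B β r = Σ≤ r (λ s → + multichoose β (r ∸ s) ℤ.* H s)

  B₀ : ∀ β → B β 0 ≡ H 0
  B₀ β = ℤₚ.*-identityˡ (H 0)

  -- One more factor 1/(1 - x) in the generating function turns coefficients into their partial
  -- sums.
  B-suc : ∀ β r → B (suc β) (suc r) ≡ B (suc β) r ℤ.+ B β (suc r)
  B-suc β r = begin
    Σ≤ r (λ s → + multichoose (suc β) (suc r ∸ s) ℤ.* H s) ℤ.+ + multichoose (suc β) (r ∸ r) ℤ.* H (suc r)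
      ≡⟨ cong₂ ℤ._+_ (Σ≤-cong r term) (cong (λ d → + multichoose (suc β) d ℤ.* H (suc r)) (n∸n≡0 r)) ⟩
    Σ≤ r (λ s → + multichoose (suc β) (r ∸ s) ℤ.* H s ℤ.+ + multichoose β (suc r ∸ s) ℤ.* H s) ℤ.+ 1ℤ ℤ.* H (suc r)
      ≡⟨ cong₂ ℤ._+_ (Σ≤-+ r _ _) (cong (λ d → + multichoose β d ℤ.* H (suc r)) (sym (n∸n≡0 r))) ⟩
    (B (suc β) r ℤ.+ Σ≤ r (λ s → + multichoose β (suc r ∸ s) ℤ.* H s)) ℤ.+ + multichoose β (r ∸ r) ℤ.* H (suc r)
      ≡⟨ ℤₚ.+-assoc (B (suc β) r) _ _ ⟩
    B (suc β) r ℤ.+ B β (suc r) ∎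
    where
    open ≡-Reasoning
    term : ∀ s → s ≤ r → + multichoose (suc β) (suc r ∸ s) ℤ.* H s ≡
             + multichoose (suc β) (r ∸ s) ℤ.* H s ℤ.+ + multichoose β (suc r ∸ s) ℤ.* H s
    term s s≤r rewrite +-∸-assoc 1 s≤r = ℤₚ.*-distribʳ-+ (H s) (+ multichoose (suc β) (r ∸ s)) (+ multichoose β (suc (r ∸ s)))

  B-zero : ∀ r → B 0 r ≡ H r
  B-zero zero    = B₀ 0
  B-zero (suc r) = begin
    Σ≤ r (λ s → + multichoose 0 (suc r ∸ s) ℤ.* H s) ℤ.+ + multichoose 0 (r ∸ r) ℤ.* H (suc r)
      ≡⟨ cong₂ ℤ._+_ (Σ≤-cong r term) (cong (λ d → + multichoose 0 d ℤ.* H (suc r)) (n∸n≡0 r)) ⟩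
    Σ≤ r (λ s → 0ℤ) ℤ.+ 1ℤ ℤ.* H (suc r)
      ≡⟨ cong₂ ℤ._+_ (zeros r) (ℤₚ.*-identityˡ (H (suc r))) ⟩
    0ℤ ℤ.+ H (suc r)
      ≡⟨ ℤₚ.+-identityˡ (H (suc r)) ⟩
    H (suc r) ∎
    where
    open ≡-Reasoning
    term : ∀ s → s ≤ r → + multichoose 0 (suc r ∸ s) ℤ.* H s ≡ 0ℤ
    term s s≤r rewrite +-∸-assoc 1 s≤r = refl
    zeros : ∀ n → Σ≤ n (λ _ → 0ℤ) ≡ 0ℤ
    zeros zero    = refl
    zeros (suc n) rewrite zeros n = refl

  -- The coefficient of x^(r-i) in (1 - x)^c, for i ≤ r.
  weight : ℕ → ℕ → ℕ → ℤ
  weight r c i = sgn (r ∸ i) ℤ.* + (c C (r ∸ i))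

  -- Multiplication by 1 - x. It fails at i = r, where truncated subtraction makes
  -- `weight r c (suc r)` equal to 1 instead of 0.
  weight-suc : ∀ r c i → i < r → weight r (suc c) i ≡ weight r c i ℤ.- weight r c (suc i)
  weight-suc (suc r) c i (s≤s i≤r)
    rewrite +-∸-assoc 1 i≤r | sym (nCk+nC[k+1]≡[n+1]C[k+1] c (r ∸ i))
    = lemma (sgn (r ∸ i)) (+ (c C (r ∸ i))) (+ (c C suc (r ∸ i)))
    where
    lemma : ∀ s x y → (-1ℤ ℤ.* s) ℤ.* (x ℤ.+ y) ≡ (-1ℤ ℤ.* s) ℤ.* y ℤ.- s ℤ.* x
    lemma = ℤ-Ring.solve-∀

  -- A truncated form of (1-x)^(c+1) (1-x)^(-c-1) = (1-x)^c (1-x)^(-c). Truncation costs a boundary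
  -- term at n. The mixed last term on the left, weight c against `B (suc c)`, splits by `B-suc`
  -- into this boundary term and the missing last term on the right.
  weight-lower : ∀ r n c → n < r →
    Σ≤ n (λ i → weight r (suc c) i ℤ.* B (suc c) i) ℤ.+ weight r c (suc n) ℤ.* B (suc c) (suc n) ≡
    Σ≤ (suc n) (λ i → weight r c i ℤ.* B c i)
  weight-lower r n c n<r = begin
    Σ≤ n (λ i → weight r (suc c) i ℤ.* B (suc c) i) ℤ.+ w (suc n) ℤ.* B (suc c) (suc n)
      ≡⟨ cong₂ (λ x y → x ℤ.+ w (suc n) ℤ.* y)
           (Σ≤-cong n (λ i i≤n → cong (ℤ._* B (suc c) i) (weight-suc r c i (≤-<-trans i≤n n<r))))
           (B-suc c n) ⟩
    S ℤ.+ w (suc n) ℤ.* (B (suc c) n ℤ.+ B c (suc n))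
      ≡⟨ lemma S (w (suc n)) (B (suc c) n) (B c (suc n)) ⟩
    (S ℤ.+ w (suc n) ℤ.* B (suc c) n) ℤ.+ w (suc n) ℤ.* B c (suc n)
      ≡⟨ cong (ℤ._+ w (suc n) ℤ.* B c (suc n))
           (Σ≤-by-parts n w (B (suc c)) (B c) (trans (B₀ (suc c)) (sym (B₀ c))) (λ i _ → B-suc c i)) ⟨
    Σ≤ (suc n) (λ i → w i ℤ.* B c i) ∎
    where
    open ≡-Reasoning
    w = weight r c
    S = Σ≤ n (λ i → (w i ℤ.- w (suc i)) ℤ.* B (suc c) i)
    lemma : ∀ S w x y → S ℤ.+ w ℤ.* (x ℤ.+ y) ≡ (S ℤ.+ w ℤ.* x) ℤ.+ w ℤ.* y
    lemma = ℤ-Ring.solve-∀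

  weight-diag : ∀ r c → weight r c r ≡ 1ℤ
  weight-diag r c rewrite n∸n≡0 r = refl

  -- The product (1-x)^c (1-x)^(-c) is 1. The diagonal weight is 1 for every c, so the last term can
  -- be read as the mixed one of `weight-lower`, and c descends to 0.
  constant-inversion : ∀ c r → Σ≤ r (λ i → weight r c i ℤ.* B c i) ≡ H r
  constant-inversion c zero    = trans (cong (1ℤ ℤ.*_) (B₀ c)) (ℤₚ.*-identityˡ (H 0))
  constant-inversion zero (suc r) = begin
    Σ≤ r (λ i → weight (suc r) 0 i ℤ.* B 0 i) ℤ.+ weight (suc r) 0 (suc r) ℤ.* B 0 (suc r)
      ≡⟨ cong₂ ℤ._+_ (vanish r ≤-refl) (cong (ℤ._* B 0 (suc r)) (weight-diag (suc r) 0)) ⟩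
    0ℤ ℤ.+ 1ℤ ℤ.* B 0 (suc r)
      ≡⟨ trans (ℤₚ.+-identityˡ _) (ℤₚ.*-identityˡ _) ⟩
    B 0 (suc r)
      ≡⟨ B-zero (suc r) ⟩
    H (suc r) ∎
    where
    open ≡-Reasoning
    weight-zero : ∀ i → i ≤ r → weight (suc r) 0 i ≡ 0ℤ
    weight-zero i i≤r rewrite +-∸-assoc 1 i≤r = ℤₚ.*-zeroʳ (sgn (suc (r ∸ i)))
    vanish : ∀ n → n ≤ r → Σ≤ n (λ i → weight (suc r) 0 i ℤ.* B 0 i) ≡ 0ℤ
    vanish zero    n≤r = cong (ℤ._* B 0 0) (weight-zero 0 n≤r)
    vanish (suc n) n≤r rewrite vanish n (<⇒≤ n≤r) | weight-zero (suc n) n≤r = refl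
  constant-inversion (suc c) (suc r) = begin
    Σ≤ r (λ i → weight (suc r) (suc c) i ℤ.* B (suc c) i) ℤ.+ weight (suc r) (suc c) (suc r) ℤ.* B (suc c) (suc r)
      ≡⟨ cong (λ x → Σ≤ r (λ i → weight (suc r) (suc c) i ℤ.* B (suc c) i) ℤ.+ x ℤ.* B (suc c) (suc r))
           (trans (weight-diag (suc r) (suc c)) (sym (weight-diag (suc r) c))) ⟩
    Σ≤ r (λ i → weight (suc r) (suc c) i ℤ.* B (suc c) i) ℤ.+ weight (suc r) c (suc r) ℤ.* B (suc c) (suc r)
      ≡⟨ weight-lower (suc r) r c ≤-refl ⟩
    Σ≤ (suc r) (λ i → weight (suc r) c i ℤ.* B c i)
      ≡⟨ constant-inversion c (suc r) ⟩
    H (suc r) ∎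
    where open ≡-Reasoning

  module _ (A : ℕ → ℕ) (drop : ∀ i → A i ≡ A (suc i) ⊎ A i ≡ suc (A (suc i))) where

    -- The weights read A one index ahead of B. While A is constant, the next term just prolongs the
    -- sum; where A drops by one, the next term is the mixed one that `weight-lower` absorbs.
    partial-inversion : ∀ r n → n ≤ r →
      Σ≤ n (λ i → weight r (A (suc i)) i ℤ.* B (A i) i) ≡
      Σ≤ n (λ i → weight r (A (suc n)) i ℤ.* B (A (suc n)) i)
    partial-inversion r zero _ = cong (weight r (A 1) 0 ℤ.*_) (trans (B₀ (A 0)) (sym (B₀ (A 1))))
    partial-inversion r (suc n) n<r
      rewrite partial-inversion r n (<⇒≤ n<r) with drop (suc n)
    ... | inj₁ eq rewrite eq = refl
    ... | inj₂ eq rewrite eq = weight-lower r n (A (suc (suc n))) n<r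

    inversion : ∀ k (G : ℕ → ℤ) →
      (∀ r → r ≤ k → H r ≡ Σ≤ r (λ i → weight r (A (suc i)) i ℤ.* G i)) →
      ∀ r → r ≤ k → G r ≡ B (A r) r
    inversion k G eqs = <-rec _ step
      where
      open ≡-Reasoning
      total : ∀ r → H r ≡ Σ≤ r (λ i → weight r (A (suc i)) i ℤ.* B (A i) i)
      total r = sym (trans (partial-inversion r r ≤-refl) (constant-inversion (A (suc r)) r))
      one : ∀ r c x → weight r c r ℤ.* x ≡ x
      one r c x rewrite weight-diag r c = ℤₚ.*-identityˡ x
      step : ∀ r → (∀ {i} → i < r → i ≤ k → G i ≡ B (A i) i) → r ≤ k → G r ≡ B (A r) r
      step zero    _  le = begin
        G 0                             ≡⟨ one 0 (A 1) (G 0) ⟨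
        weight 0 (A 1) 0 ℤ.* G 0        ≡⟨ eqs 0 le ⟨
        H 0                             ≡⟨ B₀ (A 0) ⟨
        B (A 0) 0                       ∎
      step (suc r) ih le = begin
        G (suc r)
          ≡⟨ one (suc r) (A (suc (suc r))) (G (suc r)) ⟨
        weight (suc r) (A (suc (suc r))) (suc r) ℤ.* G (suc r)
          -- Both expansions of `H (suc r)` agree below the diagonal by the induction hypothesis, so
          -- their diagonal terms agree too.
          ≡⟨ ℤ-+-cancelˡ (Σ≤ r (λ i → weight (suc r) (A (suc i)) i ℤ.* G i)) _ _
               (trans (sym (eqs (suc r) le)) (trans (total (suc r)) (cong (ℤ._+ _) (sym prefix)))) ⟩
        weight (suc r) (A (suc (suc r))) (suc r) ℤ.* B (A (suc r)) (suc r)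
          ≡⟨ one (suc r) (A (suc (suc r))) (B (A (suc r)) (suc r)) ⟩
        B (A (suc r)) (suc r) ∎
        where
        prefix : Σ≤ r (λ i → weight (suc r) (A (suc i)) i ℤ.* G i) ≡
                 Σ≤ r (λ i → weight (suc r) (A (suc i)) i ℤ.* B (A i) i)
        prefix = Σ≤-cong r (λ i i≤r → cong (weight (suc r) (A (suc i)) i ℤ.*_)
                   (ih (s≤s i≤r) (≤-trans (m≤n⇒m≤1+n i≤r) le)))

-- Polynomials

coeff-++ : ∀ {k} (p q : Poly k) e → coeff (p ++ q) e ≡ coeff p e ℤ.+ coeff q e
coeff-++ []            q e = sym (ℤₚ.+-identityˡ (coeff q e))
coeff-++ ((c , f) ∷ p) q e rewrite coeff-++ p q e = sym (ℤₚ.+-assoc (if ⌊ ≡-dec _≟_ f e ⌋ then c else 0ℤ) (coeff p e) (coeff q e))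

coeff-· : ∀ {k} z (p : Poly k) e → coeff (z ·ᴾ p) e ≡ z ℤ.* coeff p e
coeff-· z []            e = sym (ℤₚ.*-zeroʳ z)
coeff-· z ((c , f) ∷ p) e = trans (cong₂ ℤ._+_ (head (≡-dec _≟_ f e)) (coeff-· z p e))
  (sym (ℤₚ.*-distribˡ-+ z (if ⌊ ≡-dec _≟_ f e ⌋ then c else 0ℤ) (coeff p e)))
  where
  head : (d : Dec (f ≡ e)) → (if ⌊ d ⌋ then z ℤ.* c else 0ℤ) ≡ z ℤ.* (if ⌊ d ⌋ then c else 0ℤ)
  head (yes _) = refl
  head (no  _) = sym (ℤₚ.*-zeroʳ z)

*ᴾ-[] : ∀ {k} (p : Poly k) → p *ᴾ [] ≡ []
*ᴾ-[] []      = refl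
*ᴾ-[] (_ ∷ p) = *ᴾ-[] p

monomial-++ : ∀ {k} x (p q : Poly k) → [ x ] *ᴾ (p ++ q) ≡ [ x ] *ᴾ p ++ [ x ] *ᴾ q
monomial-++ x []      q = refl
monomial-++ x (y ∷ p) q = cong (_ ∷_) (monomial-++ x p q)

coeff-∷* : ∀ {k} x (p q : Poly k) e → coeff ((x ∷ p) *ᴾ q) e ≡ coeff ([ x ] *ᴾ q) e ℤ.+ coeff (p *ᴾ q) e
coeff-∷* x []      q e = sym (ℤₚ.+-identityʳ _)
coeff-∷* x (y ∷ p) q e = begin
  coeff ((x ∷ y ∷ p) *ᴾ q) e       ≡⟨ coeff-++ (mono q) _ e ⟩
  coeff (mono q) e ℤ.+ coeff ((y ∷ p) *ᴾ q) e
    ≡⟨ cong (ℤ._+ coeff ((y ∷ p) *ᴾ q) e) (ℤₚ.+-identityʳ (coeff (mono q) e)) ⟨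
  (coeff (mono q) e ℤ.+ 0ℤ) ℤ.+ coeff ((y ∷ p) *ᴾ q) e
    ≡⟨ cong (ℤ._+ coeff ((y ∷ p) *ᴾ q) e) (coeff-++ (mono q) [] e) ⟨
  coeff ([ x ] *ᴾ q) e ℤ.+ coeff ((y ∷ p) *ᴾ q) e ∎
  where
  open ≡-Reasoning
  -- The underscore is the anonymous function inside `_*ᴾ_`, recovered by unification.
  mono = Data.List.map _

coeff-*-++ : ∀ {k} (p q r : Poly k) e →
  coeff (p *ᴾ (q ++ r)) e ≡ coeff (p *ᴾ q) e ℤ.+ coeff (p *ᴾ r) e
coeff-*-++ []      q r e = refl
coeff-*-++ (x ∷ p) q r e
  rewrite coeff-∷* x p (q ++ r) e | coeff-∷* x p q e | coeff-∷* x p r e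
        | coeff-*-++ p q r e | monomial-++ x q r | coeff-++ ([ x ] *ᴾ q) ([ x ] *ᴾ r) e
  = lemma (coeff ([ x ] *ᴾ q) e) (coeff ([ x ] *ᴾ r) e) (coeff (p *ᴾ q) e) (coeff (p *ᴾ r) e)
  where
  lemma : ∀ a b c d → (a ℤ.+ b) ℤ.+ (c ℤ.+ d) ≡ (a ℤ.+ c) ℤ.+ (b ℤ.+ d)
  lemma = ℤ-Ring.solve-∀

monomial-comm : ∀ {k} x (q : Poly k) → [ x ] *ᴾ q ≡ q *ᴾ [ x ]
monomial-comm x []      = refl
monomial-comm (c , f) ((d , g) ∷ q) =
  cong₂ _∷_ (cong₂ _,_ (ℤₚ.*-comm c d) (zipWith-comm +-comm f g)) (monomial-comm (c , f) q)

coeff-*-comm : ∀ {k} (p q : Poly k) e → coeff (p *ᴾ q) e ≡ coeff (q *ᴾ p) e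
coeff-*-comm []      q e = sym (cong (λ l → coeff l e) (*ᴾ-[] q))
coeff-*-comm (x ∷ p) q e
  rewrite coeff-∷* x p q e | coeff-*-++ q [ x ] p e | coeff-*-comm p q e | monomial-comm x q = refl

monomial-· : ∀ {k} z x (q : Poly k) → [ x ] *ᴾ (z ·ᴾ q) ≡ z ·ᴾ ([ x ] *ᴾ q)
monomial-· z x       []            = refl
monomial-· z (c , f) ((d , g) ∷ q) = cong₂ _∷_ (cong (_, _) (swap c z d)) (monomial-· z (c , f) q)
  where
  swap : ∀ c z d → c ℤ.* (z ℤ.* d) ≡ z ℤ.* (c ℤ.* d)
  swap = ℤ-Ring.solve-∀

coeff-*-· : ∀ {k} z (p q : Poly k) e → coeff (p *ᴾ (z ·ᴾ q)) e ≡ z ℤ.* coeff (p *ᴾ q) e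
coeff-*-· z []            q e = sym (ℤₚ.*-zeroʳ z)
coeff-*-· z ((c , f) ∷ p) q e
  rewrite coeff-∷* (c , f) p (z ·ᴾ q) e | coeff-∷* (c , f) p q e | coeff-*-· z p q e
        | monomial-· z (c , f) q | coeff-· z ([ c , f ] *ᴾ q) e
  = sym (ℤₚ.*-distribˡ-+ z (coeff ([ c , f ] *ᴾ q) e) (coeff (p *ᴾ q) e))

coeff-Σᴾ : ∀ {k} r (i : ℕ → ℕ) (F : ℕ → Poly k) e →
  coeff (Σᴾ (applyUpTo i (suc r)) F) e ≡ Σ≤ r (λ s → coeff (F (i s)) e)
coeff-Σᴾ zero    i F e = trans (coeff-++ (F (i 0)) [] e) (ℤₚ.+-identityʳ _)
coeff-Σᴾ (suc r) i F e = begin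
  coeff (F (i 0) ++ Σᴾ (applyUpTo (λ s → i (suc s)) (suc r)) F) e
    ≡⟨ coeff-++ (F (i 0)) _ e ⟩
  coeff (F (i 0)) e ℤ.+ coeff (Σᴾ (applyUpTo (λ s → i (suc s)) (suc r)) F) e
    ≡⟨ cong (λ x → coeff (F (i 0)) e ℤ.+ x) (coeff-Σᴾ r (λ s → i (suc s)) F e) ⟩
  coeff (F (i 0)) e ℤ.+ Σ≤ r (λ s → coeff (F (i (suc s))) e)
    ≡⟨ Σ≤-front r (λ s → coeff (F (i s)) e) ⟩
  Σ≤ (suc r) (λ s → coeff (F (i s)) e) ∎
  where open ≡-Reasoning

coeff-*-Σᴾ : ∀ {k} (p : Poly k) r (i : ℕ → ℕ) (F : ℕ → Poly k) e →
  coeff (p *ᴾ Σᴾ (applyUpTo i (suc r)) F) e ≡ Σ≤ r (λ s → coeff (p *ᴾ F (i s)) e)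
coeff-*-Σᴾ p zero    i F e rewrite coeff-*-++ p (F (i 0)) [] e | *ᴾ-[] p = ℤₚ.+-identityʳ _
coeff-*-Σᴾ p (suc r) i F e
  rewrite coeff-*-++ p (F (i 0)) (Σᴾ (applyUpTo (λ s → i (suc s)) (suc r)) F) e
        | coeff-*-Σᴾ p r (λ s → i (suc s)) F e
  = Σ≤-front r (λ s → coeff (p *ᴾ F (i s)) e)

-- One strip per size makes the Pieri rule a triangular system along κ.
pieri-chain : ∀ k (g : List ℕ → Poly k) → IsKkSchur k g →
  (τ : List ℕ) → isPartitionᵇ τ ≡ true → isCoreᵇ k τ ≡ true →
  (κ : ℕ → List ℕ) (A : ℕ → ℕ) → (∀ i → A i ≡ A (suc i) ⊎ A i ≡ suc (A (suc i))) →
  (∀ s → s ≤ k → strips k τ s ≡ [ κ s ]) →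
  (∀ s → s ≤ k → rBlock k (κ s) τ ≡ A (suc s)) →
  ∀ r → r ≤ k →
  g (𝔭 k (κ r)) ≈ᴾ g (𝔭 k τ) *ᴾ
    Σᴾ (upto0 r) (λ s → binomℤ ((+ A r ℤ.+ + (r ∸ s)) ℤ.- 1ℤ) (r ∸ s) ·ᴾ h k s)
pieri-chain k g kk τ part core κ A drop strip block r r≤k e = begin
  G r
    ≡⟨ Inversion.inversion H A drop k G expansion r r≤k ⟩
  Σ≤ r (λ s → + multichoose (A r) (r ∸ s) ℤ.* H s)
    ≡⟨ Σ≤-cong r (λ s _ → term s) ⟨
  Σ≤ r (λ s → coeff (P *ᴾ (binomℤ ((+ A r ℤ.+ + (r ∸ s)) ℤ.- 1ℤ) (r ∸ s) ·ᴾ h k s)) e)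
    ≡⟨ coeff-*-Σᴾ P r id (λ s → binomℤ ((+ A r ℤ.+ + (r ∸ s)) ℤ.- 1ℤ) (r ∸ s) ·ᴾ h k s) e ⟨
  coeff (P *ᴾ Σᴾ (upto0 r) (λ s → binomℤ ((+ A r ℤ.+ + (r ∸ s)) ℤ.- 1ℤ) (r ∸ s) ·ᴾ h k s)) e ∎
  where
  open ≡-Reasoning
  P = g (𝔭 k τ)
  -- With the exponent e fixed, these are sequences of integers, so the inversion takes place in ℤ,
  -- one coefficient at a time.
  H G : ℕ → ℤ
  H s = coeff (h k s *ᴾ P) e
  G s = coeff (g (𝔭 k (κ s))) e
  term : ∀ s → coeff (P *ᴾ (binomℤ ((+ A r ℤ.+ + (r ∸ s)) ℤ.- 1ℤ) (r ∸ s) ·ᴾ h k s)) e ≡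
               + multichoose (A r) (r ∸ s) ℤ.* H s
  term s rewrite coeff-*-· (binomℤ ((+ A r ℤ.+ + (r ∸ s)) ℤ.- 1ℤ) (r ∸ s)) P (h k s) e
               | binomℤ-multichoose (A r) (r ∸ s) | coeff-*-comm P (h k s) e = refl
  expansion : ∀ r → r ≤ k → H r ≡ Σ≤ r (λ i → Inversion.weight H r (A (suc i)) i ℤ.* G i)
  expansion r r≤k = begin
    H r                         ≡⟨ IsKkSchur.pieri kk τ part core r r≤k e ⟩
    coeff (PieriRHS k g τ r) e  ≡⟨ coeff-Σᴾ r id summand e ⟩
    Σ≤ r (λ s → coeff (summand s) e)
      ≡⟨ Σ≤-cong r (λ s s≤r → summand-coeff s (≤-trans s≤r r≤k)) ⟩
    Σ≤ r (λ i → Inversion.weight H r (A (suc i)) i ℤ.* G i) ∎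
    where
    summand : ℕ → Poly k
    summand s = sgn (r ∸ s) ·ᴾ Σᴾ (strips k τ s) (λ κ → binomℤ (+ rBlock k κ τ) (r ∸ s) ·ᴾ g (𝔭 k κ))
    summand-coeff : ∀ s → s ≤ k → coeff (summand s) e ≡ Inversion.weight H r (A (suc s)) s ℤ.* G s
    summand-coeff s s≤k
      rewrite strip s s≤k
            | coeff-· (sgn (r ∸ s)) ((binomℤ (+ rBlock k (κ s) τ) (r ∸ s) ·ᴾ g (𝔭 k (κ s))) ++ []) e
            | coeff-++ (binomℤ (+ rBlock k (κ s) τ) (r ∸ s) ·ᴾ g (𝔭 k (κ s))) [] e
            | coeff-· (binomℤ (+ rBlock k (κ s) τ) (r ∸ s)) (g (𝔭 k (κ s))) e
            | block s s≤k | binomℤ-C (A (suc s)) (r ∸ s)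
      = lemma (sgn (r ∸ s)) _ (G s)
      where
      lemma : ∀ a b c → a ℤ.* (b ℤ.* c ℤ.+ 0ℤ) ≡ (a ℤ.* b) ℤ.* c
      lemma = ℤ-Ring.solve-∀

-- Hook lengths of cores, row by row

∧-true : ∀ {a b} → a ∧ b ≡ true → a ≡ true × b ≡ true
∧-true {true} eq = refl , eq

true-∧ : ∀ {a b} → a ≡ true → b ≡ true → a ∧ b ≡ true
true-∧ refl eq = eq

≤⇒≤ᵇ≡true : ∀ {m n} → m ≤ n → (m ≤ᵇ n) ≡ true
≤⇒≤ᵇ≡true {m} {n} = dec-true (m ≤? n)

<⇒≤ᵇ≡false : ∀ {m n} → n < m → (m ≤ᵇ n) ≡ false
<⇒≤ᵇ≡false {m} {n} n<m = dec-false (m ≤? n) (<⇒≱ n<m)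

≤ᵇ≡true⇒≤ : ∀ m n → (m ≤ᵇ n) ≡ true → m ≤ n
≤ᵇ≡true⇒≤ m n eq = ≤ᵇ⇒≤ m n (subst T (sym eq) _)

<⇒<ᵇ≡true : ∀ {m n} → m < n → (m <ᵇ n) ≡ true
<⇒<ᵇ≡true = ≤⇒≤ᵇ≡true

≤⇒<ᵇ≡false : ∀ {m n} → n ≤ m → (m <ᵇ n) ≡ false
≤⇒<ᵇ≡false n≤m = <⇒≤ᵇ≡false (s≤s n≤m)

≢⇒≡ᵇ≡false : ∀ {m n} → m ≢ n → (m ≡ᵇ n) ≡ false
≢⇒≡ᵇ≡false {m} {n} = dec-false (m ≟ n)

≡⇒≡ᵇ≡true : ∀ {m n} → m ≡ n → (m ≡ᵇ n) ≡ true
≡⇒≡ᵇ≡true {m} {n} = dec-true (m ≟ n)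

≡ᵇ≡true⇒≡ : ∀ m n → (m ≡ᵇ n) ≡ true → m ≡ n
≡ᵇ≡true⇒≡ m n eq = ≡ᵇ⇒≡ m n (subst T (sym eq) _)

module _ {A : Set} where

  all-cong : ∀ {p q : A → Bool} {xs} → All (λ x → p x ≡ q x) xs → Defs.all p xs ≡ Defs.all q xs
  all-cong []         = refl
  all-cong (eq ∷ eqs) = cong₂ _∧_ eq (all-cong eqs)

  all-++ : ∀ (p : A → Bool) xs ys → Defs.all p (xs ++ ys) ≡ Defs.all p xs ∧ Defs.all p ys
  all-++ p []       ys = refl
  all-++ p (x ∷ xs) ys with p x
  ... | true  = all-++ p xs ys
  ... | false = refl

  all-map : ∀ {B : Set} (p : A → Bool) (f : B → A) xs → Defs.all p (map f xs) ≡ Defs.all (p ∘ f) xs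
  all-map p f []       = refl
  all-map p f (x ∷ xs) = cong (p (f x) ∧_) (all-map p f xs)

  all⁺ : ∀ (p : A → Bool) {xs} → All (λ x → p x ≡ true) xs → Defs.all p xs ≡ true
  all⁺ p []         = refl
  all⁺ p (px ∷ pxs) = true-∧ px (all⁺ p pxs)

  all⁻ : ∀ (p : A → Bool) xs → Defs.all p xs ≡ true → All (λ x → p x ≡ true) xs
  all⁻ p []       _  = []
  all⁻ p (x ∷ xs) eq = proj₁ (∧-true eq) ∷ all⁻ p xs (proj₂ (∧-true eq))

  filterᵇ-cong : ∀ {p q : A → Bool} {xs} → All (λ x → p x ≡ q x) xs → filterᵇ p xs ≡ filterᵇ q xs
  filterᵇ-cong [] = refl
  filterᵇ-cong {p} {q} {x ∷ _} (eq ∷ eqs) with p x | q x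
  filterᵇ-cong (refl ∷ eqs) | true  | _ = cong (_ ∷_) (filterᵇ-cong eqs)
  filterᵇ-cong (refl ∷ eqs) | false | _ = filterᵇ-cong eqs

  length-filterᵇ-map : ∀ {B : Set} (p : A → Bool) (f : B → A) xs →
    length (filterᵇ p (map f xs)) ≡ length (filterᵇ (p ∘ f) xs)
  length-filterᵇ-map p f []       = refl
  length-filterᵇ-map p f (x ∷ xs) with p (f x)
  ... | true  = cong suc (length-filterᵇ-map p f xs)
  ... | false = length-filterᵇ-map p f xs

upto1-All : ∀ {P : ℕ → Set} n → (∀ {j} → 1 ≤ j → j ≤ n → P j) → All P (upto1 n)
upto1-All n P = Allₚ.applyUpTo⁺₁ suc n (λ i<n → P (s≤s z≤n) i<n)

upto1-All⁻ : ∀ {P : ℕ → Set} n → All P (upto1 n) → ∀ {j} → 1 ≤ j → j ≤ n → P j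
upto1-All⁻ n Ps {suc j} _ j<n = Allₚ.applyUpTo⁻ suc n Ps j<n

Descending : List ℕ → Set
Descending = AllPairs _≥_

row-All : ∀ {b κ} → All (_≤ b) κ → ∀ i → row κ i ≤ b
row-All []         _             = z≤n
row-All (x≤b ∷ _)  zero          = z≤n
row-All (x≤b ∷ _)  (suc zero)    = x≤b
row-All (_ ∷ κ≤b)  (suc (suc i)) = row-All κ≤b (suc i)

row-antitone : ∀ {κ} → Descending κ → ∀ {i j} → i ≤ j → row κ (suc j) ≤ row κ (suc i)
row-antitone []         _                        = z≤n
row-antitone (x≥ ∷ _)   {zero}  {zero}  _         = ≤-refl
row-antitone (x≥ ∷ _)   {zero}  {suc j} _         = row-All x≥ (suc j)
row-antitone (_ ∷ desc) {suc i} {suc j} (s≤s i≤j) = row-antitone desc i≤j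

conj-∷ : ∀ x κ {j} → j ≤ x → conj (x ∷ κ) j ≡ suc (conj κ j)
conj-∷ x κ j≤x rewrite ≤⇒≤ᵇ≡true j≤x = refl

conj-beyond : ∀ {b j} κ → All (_≤ b) κ → b < j → conj κ j ≡ 0
conj-beyond []      []          b<j = refl
conj-beyond (x ∷ κ) (x≤b ∷ κ≤b) b<j rewrite <⇒≤ᵇ≡false (≤-<-trans x≤b b<j) = conj-beyond κ κ≤b b<j

≤row⇒≤conj : ∀ {κ} → Descending κ → ∀ i {j} → 1 ≤ j → j ≤ row κ (suc i) → suc i ≤ conj κ j
≤row⇒≤conj [] i 1≤j j≤0 = ⊥-elim (<⇒≱ 1≤j j≤0)
≤row⇒≤conj {x ∷ κ} (x≥ ∷ desc) zero    1≤j j≤x rewrite conj-∷ x κ j≤x = s≤s z≤n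
≤row⇒≤conj {x ∷ κ} (x≥ ∷ desc) (suc i) 1≤j j≤r
  rewrite conj-∷ x κ (≤-trans j≤r (row-All x≥ (suc i))) = s≤s (≤row⇒≤conj desc i 1≤j j≤r)

≤conj⇒≤row : ∀ {κ} → Descending κ → ∀ i {j} → suc i ≤ conj κ j → j ≤ row κ (suc i)
≤conj⇒≤row {x ∷ κ} (x≥ ∷ desc) i {j} i<c with j ≤? x
≤conj⇒≤row {x ∷ κ} (x≥ ∷ desc) zero    i<c | yes j≤x = j≤x
≤conj⇒≤row {x ∷ κ} (x≥ ∷ desc) (suc i) i<c | yes j≤x
  rewrite conj-∷ x κ j≤x = ≤conj⇒≤row desc i (≤-pred i<c)
... | no j≰x rewrite conj-beyond (x ∷ κ) (≤-refl ∷ x≥) (≰⇒> j≰x) = contradiction i<c λ ()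

hook-first : ∀ x κ j → j ≤ x → hook (x ∷ κ) 1 j ≡ suc ((x ∸ j) + conj κ j)
hook-first x κ j j≤x rewrite conj-∷ x κ j≤x = begin
  (x + suc c + 1) ∸ suc j          ≡⟨ cong (_∸ suc j) (+-comm (x + suc c) 1) ⟩
  (x + suc c) ∸ j                  ≡⟨ cong (_∸ j) (+-comm x (suc c)) ⟩
  (suc c + x) ∸ j                  ≡⟨ +-∸-assoc (suc c) j≤x ⟩
  suc (c + (x ∸ j))                ≡⟨ cong suc (+-comm c (x ∸ j)) ⟩
  suc ((x ∸ j) + c)                ∎
  where
  open ≡-Reasoning
  c = conj κ j

-- A hook sees only its own row and the rows above, so removing the bottom row merely shifts the row
-- index. This is what permits induction from the top of the diagram.
hook-above : ∀ x κ i j → j ≤ x → hook (x ∷ κ) (suc (suc i)) j ≡ hook κ (suc i) j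
hook-above x κ i j j≤x rewrite conj-∷ x κ j≤x | +-suc (row κ (suc i)) (conj κ j) = refl

count-beyond : ∀ n c → length (filterᵇ (c <ᵇ_) (upto1 (n + c))) ≡ n
count-beyond zero c =
  cong length (filter-none _ (upto1-All c (λ _ j≤c → λ t → <⇒≱ (<ᵇ⇒< c _ t) j≤c)))
count-beyond (suc n) c = begin
  length (filterᵇ (c <ᵇ_) (upto1 (suc (n + c))))
    ≡⟨ cong (length ∘ filterᵇ (c <ᵇ_)) (sym (applyUpTo-∷ʳ suc (n + c))) ⟩
  length (filterᵇ (c <ᵇ_) (upto1 (n + c) ++ [ suc (n + c) ]))
    ≡⟨ cong length (filter-++ _ (upto1 (n + c)) _) ⟩
  length (filterᵇ (c <ᵇ_) (upto1 (n + c)) ++ filterᵇ (c <ᵇ_) [ suc (n + c) ])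
    ≡⟨ length-++ (filterᵇ (c <ᵇ_) (upto1 (n + c))) ⟩
  length (filterᵇ (c <ᵇ_) (upto1 (n + c))) + length (filterᵇ (c <ᵇ_) [ suc (n + c) ])
    ≡⟨ cong₂ _+_ (count-beyond n c) last ⟩
  n + 1
    ≡⟨ +-comm n 1 ⟩
  suc n ∎
  where
  open ≡-Reasoning
  last : length (filterᵇ (c <ᵇ_) [ suc (n + c) ]) ≡ 1
  last rewrite <⇒<ᵇ≡true {c} {suc (n + c)} (s≤s (m≤n+m c n)) = refl

-- CoreRows k κ μ says that κ is built from the top by the recursion for 𝔠(μ): a row with n
-- cells of hook length ≤ k below κ has n + κ_{k+1-n} cells.
data CoreRows (k : ℕ) : List ℕ → List ℕ → Set where
  []  : CoreRows k [] []
  row∷ : ∀ {x n κ μ} → n ≤ k → x ≡ n + row κ (suc (k ∸ n)) → CoreRows k κ μ → CoreRows k (x ∷ κ) (n ∷ μ)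

module _ (k : ℕ) where

  hookᵇ≢ : List ℕ → ℕ → ℕ → Bool
  hookᵇ≢ κ i j = not (hook κ i j ≡ᵇ suc k)

  coreFrom : List ℕ → ℕ → List ℕ → Bool
  coreFrom κ i []       = true
  coreFrom κ i (y ∷ ys) = Defs.all (hookᵇ≢ κ i) (upto1 y) ∧ coreFrom κ (suc i) ys

  isCoreᵇ-rows : ∀ κ → isCoreᵇ k κ ≡ coreFrom κ 1 κ
  -- The first step exchanges the anonymous predicate of `isCoreᵇ` for `p`, with which it agrees at
  -- every cell.
  isCoreᵇ-rows κ = trans (all-cong (All.universal (λ _ → refl) (cells κ))) (rows 1 κ)
    where
    p : ℕ × ℕ → Bool
    p (i , j) = hookᵇ≢ κ i j
    rows : ∀ i ys → Defs.all p (cellsFrom i ys) ≡ coreFrom κ i ys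
    rows i []       = refl
    rows i (y ∷ ys) = trans (all-++ p (map (i ,_) (upto1 y)) _) (cong₂ _∧_ (all-map p (i ,_) (upto1 y)) (rows (suc i) ys))

  coreFrom-above : ∀ x κ i {ys} → All (_≤ x) ys → coreFrom (x ∷ κ) (suc (suc i)) ys ≡ coreFrom κ (suc i) ys
  coreFrom-above x κ i []                  = refl
  coreFrom-above x κ i (_∷_ {y} y≤x ys≤x) = cong₂ _∧_
    (all-cong (upto1-All y (λ {j} _ j≤y → cong (λ z → not (z ≡ᵇ suc k)) (hook-above x κ i j (≤-trans j≤y y≤x)))))
    (coreFrom-above x κ (suc i) ys≤x)

  pRows-above : ∀ x κ i {ys} → All (_≤ x) ys → pRows k (x ∷ κ) (suc (suc i)) ys ≡ pRows k κ (suc i) ys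
  pRows-above x κ i []                  = refl
  pRows-above x κ i (_∷_ {y} y≤x ys≤x) = cong₂ _∷_
    (cong length (filterᵇ-cong (upto1-All y (λ {j} _ j≤y → cong (_≤ᵇ k) (hook-above x κ i j (≤-trans j≤y y≤x))))))
    (pRows-above x κ (suc i) ys≤x)

  size<-pRows : ∀ κ → size< k κ ≡ sum (pRows k κ 1 κ)
  size<-pRows κ = trans (cong length (filterᵇ-cong (All.universal (λ _ → refl) (cells κ)))) (rows 1 κ)
    where
    open ≡-Reasoning
    p : ℕ × ℕ → Bool
    p (i , j) = hook κ i j ≤ᵇ k
    rows : ∀ i ys → length (filterᵇ p (cellsFrom i ys)) ≡ sum (pRows k κ i ys)
    rows i []       = refl
    rows i (y ∷ ys) = begin
      length (filterᵇ p (map (i ,_) (upto1 y) ++ cellsFrom (suc i) ys))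
        ≡⟨ cong length (filter-++ _ (map (i ,_) (upto1 y)) _) ⟩
      length (filterᵇ p (map (i ,_) (upto1 y)) ++ filterᵇ p (cellsFrom (suc i) ys))
        ≡⟨ length-++ (filterᵇ p (map (i ,_) (upto1 y))) ⟩
      length (filterᵇ p (map (i ,_) (upto1 y))) + length (filterᵇ p (cellsFrom (suc i) ys))
        ≡⟨ cong₂ _+_ (length-filterᵇ-map p (i ,_) (upto1 y)) (rows (suc i) ys) ⟩
      sum (pRows k κ i (y ∷ ys)) ∎

  module _ {κ} (desc : Descending κ) {n} (n≤k : n ≤ k) where

    private
      c = row κ (suc (k ∸ n))

    -- Up to column c the arm is at least n and the leg at least k + 1 - n, so the hook is at least
    -- k + 2. Beyond c the arm is below n and the leg at most k - n, so the hook is at most k. The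
    -- value k + 1 is jumped over.
    large-hook : ∀ {j} → 1 ≤ j → j ≤ c → suc k < hook (n + c ∷ κ) 1 j
    large-hook {j} 1≤j j≤c rewrite hook-first (n + c) κ j (≤-trans j≤c (m≤n+m c n)) = s≤s (begin
      suc k                      ≡⟨ cong suc (m+[n∸m]≡n n≤k) ⟨
      suc (n + (k ∸ n))          ≡⟨ +-suc n (k ∸ n) ⟨
      n + suc (k ∸ n)            ≤⟨ +-mono-≤ (m≤m+n n (c ∸ j)) (≤row⇒≤conj desc (k ∸ n) 1≤j j≤c) ⟩
      (n + (c ∸ j)) + conj κ j   ≡⟨ cong (_+ conj κ j) (+-∸-assoc n j≤c) ⟨
      (n + c ∸ j) + conj κ j     ∎)
      where open ≤-Reasoning

    small-hook : ∀ {j} → c < j → j ≤ n + c → hook (n + c ∷ κ) 1 j ≤ k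
    small-hook {j} c<j j≤x rewrite hook-first (n + c) κ j j≤x = begin
      suc (n + c ∸ j) + conj κ j   ≤⟨ +-mono-≤ arm leg ⟩
      n + (k ∸ n)                  ≡⟨ m+[n∸m]≡n n≤k ⟩
      k                            ∎
      where
      open ≤-Reasoning
      arm : suc (n + c ∸ j) ≤ n
      arm = begin
        suc (n + c ∸ j)       ≡⟨ +-∸-assoc 1 j≤x ⟨
        suc (n + c) ∸ j       ≤⟨ ∸-monoʳ-≤ (suc (n + c)) c<j ⟩
        n + c ∸ c             ≡⟨ m+n∸n≡m n c ⟩
        n                     ∎
      leg : conj κ j ≤ k ∸ n
      leg = ≮⇒≥ (λ lt → <⇒≱ c<j (≤conj⇒≤row desc (k ∸ n) lt))

    first-row-hooks : Defs.all (hookᵇ≢ (n + c ∷ κ) 1) (upto1 (n + c)) ≡ true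
    first-row-hooks = all⁺ _ (upto1-All (n + c) λ {j} 1≤j j≤x → cong not (≢⇒≡ᵇ≡false (differs 1≤j j≤x)))
      where
      differs : ∀ {j} → 1 ≤ j → j ≤ n + c → hook (n + c ∷ κ) 1 j ≢ suc k
      differs {j} 1≤j j≤x eq with j ≤? c
      ... | yes j≤c = <⇒≢ (large-hook 1≤j j≤c) (sym eq)
      ... | no  j≰c = <⇒≢ (s≤s (small-hook (≰⇒> j≰c) j≤x)) eq

    first-row-count : length (filterᵇ (λ j → hook (n + c ∷ κ) 1 j ≤ᵇ k) (upto1 (n + c))) ≡ n
    first-row-count = trans (cong length (filterᵇ-cong (upto1-All (n + c) agree))) (count-beyond n c)
      where
      agree : ∀ {j} → 1 ≤ j → j ≤ n + c → (hook (n + c ∷ κ) 1 j ≤ᵇ k) ≡ (c <ᵇ j)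
      agree {j} 1≤j j≤x with j ≤? c
      ... | yes j≤c = trans (<⇒≤ᵇ≡false (<-trans (n<1+n k) (large-hook 1≤j j≤c))) (sym (≤⇒<ᵇ≡false j≤c))
      ... | no  j≰c = trans (≤⇒≤ᵇ≡true (small-hook (≰⇒> j≰c) j≤x)) (sym (<⇒<ᵇ≡true (≰⇒> j≰c)))

  CoreRows⇒core : ∀ {κ μ} → Descending κ → CoreRows k κ μ → isCoreᵇ k κ ≡ true
  CoreRows⇒core {κ} desc cr = trans (isCoreᵇ-rows κ) (go desc cr)
    where
    go : ∀ {κ μ} → Descending κ → CoreRows k κ μ → coreFrom κ 1 κ ≡ true
    go []          []                        = refl
    go (x≥ ∷ desc) (row∷ {x} {n} {κ} n≤k refl cr) =
      true-∧ (first-row-hooks desc n≤k) (trans (coreFrom-above x κ 0 x≥) (go desc cr))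

  CoreRows⇒pRows : ∀ {κ μ} → Descending κ → CoreRows k κ μ → pRows k κ 1 κ ≡ μ
  CoreRows⇒pRows []          []                        = refl
  CoreRows⇒pRows (x≥ ∷ desc) (row∷ {x} {n} {κ} n≤k refl cr) =
    cong₂ _∷_ (first-row-count desc n≤k) (trans (pRows-above x κ 0 x≥) (CoreRows⇒pRows desc cr))

  -- n counts the columns already known to have hook length ≤ k, starting from the right end.
  first-row-search : ∀ {x κ} → Descending κ → (∀ j → 1 ≤ j → j ≤ x → hook (x ∷ κ) 1 j ≢ suc k) →
    ∀ c n → x ≡ n + c → n + conj κ (suc c) ≤ k → ∃ λ n → n ≤ k × x ≡ n + row κ (suc (k ∸ n))
  first-row-search {x} {κ} desc no-hook c n x≡ small = case c x≡ row≤
    where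
    n≤k : n ≤ k
    n≤k = ≤-trans (m≤m+n n _) small
    1+k≡ : suc k ≡ n + suc (k ∸ n)
    1+k≡ = trans (cong suc (sym (m+[n∸m]≡n n≤k))) (sym (+-suc n (k ∸ n)))
    row≤ : row κ (suc (k ∸ n)) ≤ c
    row≤ = ≮⇒≥ λ c<r → <⇒≱ (≤-refl {suc k}) (begin
      suc k                 ≡⟨ 1+k≡ ⟩
      n + suc (k ∸ n)       ≤⟨ +-monoʳ-≤ n (≤row⇒≤conj desc (k ∸ n) (s≤s z≤n) c<r) ⟩
      n + conj κ (suc c)    ≤⟨ small ⟩
      k                     ∎)
      where open ≤-Reasoning
    hook≡ : ∀ c → x ≡ n + suc c → hook (x ∷ κ) 1 (suc c) ≡ suc (n + conj κ (suc c))
    hook≡ c refl = trans (hook-first (n + suc c) κ (suc c) (m≤n+m (suc c) n))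
                         (cong (λ z → suc (z + conj κ (suc c))) (m+n∸n≡m n (suc c)))
    case : ∀ c → x ≡ n + c → row κ (suc (k ∸ n)) ≤ c → ∃ λ n → n ≤ k × x ≡ n + row κ (suc (k ∸ n))
    case zero    x≡ r≤ = n , n≤k , trans x≡ (cong (λ z → n + z) (sym (n≤0⇒n≡0 r≤)))
    case (suc c) x≡ r≤ with <-cmp (n + conj κ (suc c)) k
    -- Column c + 1 has hook 1 + n + leg. At most k: it joins the small columns. Exactly k + 1:
    -- excluded in a core. More: row k + 1 - n of κ reaches this column, and by `row≤` ends there.
    ... | tri< lt _ _ = first-row-search desc no-hook c (suc n) (trans x≡ (+-suc n c)) lt
    ... | tri≈ _ eq _ = ⊥-elim (no-hook (suc c) (s≤s z≤n) (subst (suc c ≤_) (sym x≡) (m≤n+m (suc c) n))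
                                  (trans (hook≡ c x≡) (cong suc eq)))
    ... | tri> _ _ gt = n , n≤k , trans x≡ (cong (λ z → n + z) (≤-antisym
            (≤conj⇒≤row desc (k ∸ n) (+-cancelˡ-≤ n _ _ (subst (_≤ n + conj κ (suc c)) 1+k≡ gt))) r≤))

  core⇒CoreRows : ∀ {κ} → Descending κ → isCoreᵇ k κ ≡ true → ∃ (CoreRows k κ)
  core⇒CoreRows {κ} desc core = go desc (trans (sym (isCoreᵇ-rows κ)) core)
    where
    go : ∀ {κ} → Descending κ → coreFrom κ 1 κ ≡ true → ∃ (CoreRows k κ)
    go {[]} [] _ = [] , []
    go {x ∷ κ} (x≥ ∷ desc) eq
      with first-row-search desc no-hook x 0 refl (subst (_≤ k) (sym (conj-beyond κ x≥ ≤-refl)) z≤n)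
         | go desc (trans (sym (coreFrom-above x κ 0 x≥)) (proj₂ (∧-true eq)))
      where
      no-hook : ∀ j → 1 ≤ j → j ≤ x → hook (x ∷ κ) 1 j ≢ suc k
      no-hook j 1≤j j≤x heq
        with upto1-All⁻ x (all⁻ _ (upto1 x) (proj₁ (∧-true eq))) 1≤j j≤x
      ... | b rewrite ≡⇒≡ᵇ≡true heq = contradiction b λ ()
    ... | n , n≤k , x≡ | μ , cr = n ∷ μ , row∷ n≤k x≡ cr

-- The cores of P ∪ (s)

row-replicate-< : ∀ {n i} x κ → i < n → row (replicate n x ++ κ) (suc i) ≡ x
row-replicate-< {suc n} {zero}  x κ _         = refl
row-replicate-< {suc n} {suc i} x κ (s≤s i<n) = row-replicate-< x κ i<n

row-replicate-≥ : ∀ n i x κ → row (replicate n x ++ κ) (suc (n + i)) ≡ row κ (suc i)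
row-replicate-≥ zero    i x κ = refl
row-replicate-≥ (suc n) i x κ = row-replicate-≥ n i x κ

Descending-replicate : ∀ n {x κ} → All (_≤ x) κ → Descending κ → Descending (replicate n x ++ κ)
Descending-replicate zero    κ≤x desc = desc
Descending-replicate (suc n) κ≤x desc =
  ++⁺ (replicate⁺ n ≤-refl) κ≤x ∷ Descending-replicate n κ≤x desc

-- A larger n looks fewer rows up and so finds a row at least as long. Hence the length of a row
-- determines its number of small hooks.
row-shift-strict : ∀ {k κ} → Descending κ → ∀ {m n} → m < n → n ≤ k →
  m + row κ (suc (k ∸ m)) < n + row κ (suc (k ∸ n))
row-shift-strict {k} desc {m} {n} m<n n≤k =
  +-mono-<-≤ m<n (row-antitone desc (∸-monoʳ-≤ k (<⇒≤ m<n)))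

row-shift-injective : ∀ {k κ} → Descending κ → ∀ {m n} → m ≤ k → n ≤ k →
  m + row κ (suc (k ∸ m)) ≡ n + row κ (suc (k ∸ n)) → m ≡ n
row-shift-injective desc {m} {n} m≤k n≤k eq with <-cmp m n
... | tri< m<n _ _ = ⊥-elim (<⇒≢ (row-shift-strict desc m<n n≤k) eq)
... | tri≈ _ m≡n _ = m≡n
... | tri> _ _ n<m = ⊥-elim (<⇒≢ (row-shift-strict desc n<m m≤k) (sym eq))

top : ℕ → List ℕ
top zero    = []
top (suc e) = [ suc e ]

module _ (k : ℕ) where

  -- The k-rectangle R_t is a block of k + 1 - t rows; a list of blocks is read from the bottom up.
  data Blocks : List ℕ → Set where
    []    : Blocks []
    block : ∀ {t ts} → 1 ≤ t → t ≤ k → All (_≤ t) ts → Blocks ts → Blocks (t ∷ ts)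

  -- Insertion of the part e: at each block the larger of e and t stays in the bottom row and the
  -- smaller is carried on. A carried 0 adds no part.
  partition : ℕ → List ℕ → List ℕ
  partition e []       = top e
  partition e (t ∷ ts) = (e ⊔ t) ∷ replicate (k ∸ t) t ++ partition (e ⊓ t) ts

  -- The rows of a block have length t plus the widths of all blocks above it, and only the bottom
  -- row of the block receives cells.
  core : ℕ → List ℕ → List ℕ
  core e []       = top e
  core e (t ∷ ts) = (sum (t ∷ ts) + e) ∷ replicate (k ∸ t) (sum (t ∷ ts)) ++ core (e ⊓ t) ts

  -- core e ts with a row on top of all blocks even when that row is empty, as in the lists of choices
  core⁺ : ℕ → List ℕ → List ℕ
  core⁺ e []       = [ e ]
  core⁺ e (t ∷ ts) = (sum (t ∷ ts) + e) ∷ replicate (k ∸ t) (sum (t ∷ ts)) ++ core⁺ (e ⊓ t) ts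

  -- Horizontal strips over core 0 ts with e cells in the bottom row, with and without the empty top row.
  data Strip : List ℕ → ℕ → List ℕ → List ℕ → Set where
    []    : ∀ {e} → Strip [] e [ e ] (top e)
    block : ∀ {t ts e e′ κ⁺ κ} → e′ ≤ t → Strip ts e′ κ⁺ κ →
      Strip (t ∷ ts) e ((sum (t ∷ ts) + e) ∷ replicate (k ∸ t) (sum (t ∷ ts)) ++ κ⁺)
                       ((sum (t ∷ ts) + e) ∷ replicate (k ∸ t) (sum (t ∷ ts)) ++ κ)

  core-strip : ∀ ts e → Strip ts e (core⁺ e ts) (core e ts)
  core-strip []       e = []
  core-strip (t ∷ ts) e = block (m⊓n≤n e t) (core-strip ts (e ⊓ t))

  top≤ : ∀ e → All (_≤ e) (top e)
  top≤ zero    = []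
  top≤ (suc e) = ≤-refl ∷ []

  top-desc : ∀ e → Descending (top e)
  top-desc zero    = []
  top-desc (suc e) = [] ∷ []

  strip≤ : ∀ {ts e κ⁺ κ} → Strip ts e κ⁺ κ → All (_≤ sum ts + e) κ
  strip-above≤ : ∀ {t ts e κ⁺ κ} → e ≤ t → Strip ts e κ⁺ κ → All (_≤ sum (t ∷ ts)) κ

  strip≤ ([] {e})      = top≤ e
  strip≤ (block {t} {ts} {e} e′≤t st) = ≤-refl ∷
    ++⁺ (replicate⁺ (k ∸ t) (m≤m+n _ e)) (All.map (λ y≤ → ≤-trans y≤ (m≤m+n _ e)) (strip-above≤ e′≤t st))

  strip-above≤ {t} {ts} e≤t st =
    All.map (λ y≤ → ≤-trans y≤ (≤-trans (+-monoʳ-≤ (sum ts) e≤t) (≤-reflexive (+-comm (sum ts) t)))) (strip≤ st)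

  strip-desc : ∀ {ts e κ⁺ κ} → Strip ts e κ⁺ κ → Descending κ
  strip-tail-desc : ∀ {t ts e κ⁺ κ} → e ≤ t → Strip ts e κ⁺ κ → ∀ j → Descending (replicate j (sum (t ∷ ts)) ++ κ)

  strip-desc ([] {e}) = top-desc e
  strip-desc s@(block {t} {ts} {e} e′≤t st) with strip≤ s
  ... | _ ∷ bound = bound ∷ strip-tail-desc e′≤t st (k ∸ t)

  strip-tail-desc e≤t st j = Descending-replicate j (strip-above≤ e≤t st) (strip-desc st)

  row-top-1 : ∀ e → row (top e) 1 ≡ e
  row-top-1 zero    = refl
  row-top-1 (suc e) = refl

  row-top-2+ : ∀ e i → row (top e) (suc (suc i)) ≡ 0
  row-top-2+ zero    i = refl
  row-top-2+ (suc e) i = refl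

  strip-row-1 : ∀ {ts e κ⁺ κ} → Strip ts e κ⁺ κ → row κ 1 ≡ sum ts + e
  strip-row-1 ([] {e})    = row-top-1 e
  strip-row-1 (block _ _) = refl

  strip-row-2+≤ : ∀ {ts e κ⁺ κ} → Strip ts e κ⁺ κ → ∀ i → row κ (suc (suc i)) ≤ sum ts
  strip-row-2+≤ ([] {e})                  i = ≤-reflexive (row-top-2+ e i)
  strip-row-2+≤ (block {t} {ts} e′≤t st) i =
    row-All (++⁺ (replicate⁺ (k ∸ t) ≤-refl) (strip-above≤ e′≤t st)) (suc i)

  -- A block with t′ ≤ t is at least as tall as R_t, so these rows are still in the first block
  -- above, past its bottom row.
  strip-row-2+ : ∀ {t ts e κ⁺ κ} → All (_≤ t) ts → Strip ts e κ⁺ κ → ∀ i → i < k ∸ t → row κ (suc (suc i)) ≡ sum ts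
  strip-row-2+ _         ([] {e})      i _  = row-top-2+ e i
  strip-row-2+ (t′≤t ∷ _) (block _ _) i i< = row-replicate-< _ _ (<-≤-trans i< (∸-monoʳ-≤ k t′≤t))

  module _ {t ts e κ⁺ κ} (t≤k : t ≤ k) (ts≤t : All (_≤ t) ts) (e≤t : e ≤ t) (st : Strip ts e κ⁺ κ) where

    private
      W = sum (t ∷ ts)

    -- Every row of the block except the bottom one, looking k + 1 - t rows up, lands past the first
    -- row of the tail, where the strip has added nothing to the next block.
    row-below-tail : ∀ j → j < k ∸ t → W ≡ t + row (replicate j W ++ κ) (suc (k ∸ t))
    row-below-tail j j<h with m≤n⇒∃[o]m+o≡n j<h
    ... | d , eq = cong (λ z → t + z) (sym (begin
      row (replicate j W ++ κ) (suc (k ∸ t))   ≡⟨ cong (λ z → row (replicate j W ++ κ) (suc z)) k∸t≡ ⟩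
      row (replicate j W ++ κ) (suc (j + suc d)) ≡⟨ row-replicate-≥ j (suc d) W κ ⟩
      row κ (suc (suc d))                      ≡⟨ strip-row-2+ ts≤t st d d<h ⟩
      sum ts                                   ∎))
      where
      open ≡-Reasoning
      k∸t≡ : k ∸ t ≡ j + suc d
      k∸t≡ = trans (sym eq) (sym (+-suc j d))
      d<h : d < k ∸ t
      d<h = subst (d <_) (sym k∸t≡) (m≤n+m (suc d) j)

    tail-CoreRows : ∀ {μ} → CoreRows k κ μ → ∀ j → j ≤ k ∸ t → CoreRows k (replicate j W ++ κ) (replicate j t ++ μ)
    tail-CoreRows cr zero    _   = cr
    tail-CoreRows cr (suc j) j<h = row∷ t≤k (row-below-tail j j<h) (tail-CoreRows cr j (<⇒≤ j<h))

    tail-CoreRows⁻ : ∀ {μ} j → j ≤ k ∸ t → CoreRows k (replicate j W ++ κ) μ →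
      ∃ λ μ′ → μ ≡ replicate j t ++ μ′ × CoreRows k κ μ′
    tail-CoreRows⁻ zero    _   cr = _ , refl , cr
    tail-CoreRows⁻ (suc j) j<h (row∷ n≤k W≡ cr) with tail-CoreRows⁻ j (<⇒≤ j<h) cr
    ... | μ′ , refl , cr′ =
      μ′ , cong (_∷ _) (row-shift-injective (strip-tail-desc e≤t st j) n≤k t≤k (trans (sym W≡) (row-below-tail j j<h))) , cr′

    -- The length of the bottom row of the block if it has n small hooks. For n = t it inherits the
    -- overhang e of the tail; for n > t it looks up a row of its own block and overhangs by n; for
    -- n < t it is shorter than W.
    start-row : ℕ → ℕ
    start-row n = n + row (replicate (k ∸ t) W ++ κ) (suc (k ∸ n))

    start-row-≡ : start-row t ≡ W + e
    start-row-≡ = begin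
      t + row (replicate (k ∸ t) W ++ κ) (suc (k ∸ t))
        ≡⟨ cong (λ z → t + row (replicate (k ∸ t) W ++ κ) (suc z)) (sym (+-identityʳ (k ∸ t))) ⟩
      t + row (replicate (k ∸ t) W ++ κ) (suc ((k ∸ t) + 0))
        ≡⟨ cong (λ z → t + z) (trans (row-replicate-≥ (k ∸ t) 0 W κ) (strip-row-1 st)) ⟩
      t + (sum ts + e)
        ≡⟨ +-assoc t (sum ts) e ⟨
      W + e ∎
      where open ≡-Reasoning

    start-row-> : ∀ {n} → t < n → n ≤ k → start-row n ≡ W + n
    start-row-> {n} t<n n≤k =
      trans (cong (λ z → n + z) (row-replicate-< W κ (∸-monoʳ-< t<n n≤k))) (+-comm n W)

    start-row-< : ∀ {n} → n < t → start-row n < W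
    start-row-< {n} n<t with m≤n⇒∃[o]m+o≡n (∸-monoʳ-< n<t t≤k)
    ... | d , eq = +-mono-<-≤ n<t (begin
      row (replicate (k ∸ t) W ++ κ) (suc (k ∸ n))
        ≡⟨ cong (λ z → row (replicate (k ∸ t) W ++ κ) (suc z)) (sym (trans (+-suc (k ∸ t) d) eq)) ⟩
      row (replicate (k ∸ t) W ++ κ) (suc ((k ∸ t) + suc d))
        ≡⟨ row-replicate-≥ (k ∸ t) (suc d) W κ ⟩
      row κ (suc (suc d))
        ≤⟨ strip-row-2+≤ st d ⟩
      sum ts ∎)
      where open ≤-Reasoning

  top-CoreRows : ∀ e → e ≤ k → CoreRows k (top e) (top e)
  top-CoreRows zero    _   = []
  top-CoreRows (suc e) e≤k = row∷ e≤k (sym (+-identityʳ (suc e))) []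

  core-CoreRows : ∀ {ts} → Blocks ts → ∀ {e} → e ≤ k → CoreRows k (core e ts) (partition e ts)
  core-CoreRows [] {e} e≤k = top-CoreRows e e≤k
  core-CoreRows {t ∷ ts} (block 1≤t t≤k ts≤t bs) {e} e≤k =
    row∷ (⊔-lub e≤k t≤k) (sym start)
      (tail-CoreRows t≤k ts≤t e′≤t st (core-CoreRows bs (≤-trans (m⊓n≤m e t) e≤k)) (k ∸ t) ≤-refl)
    where
    e′≤t = m⊓n≤n e t
    st = core-strip ts (e ⊓ t)
    start : start-row t≤k ts≤t e′≤t st (e ⊔ t) ≡ sum (t ∷ ts) + e
    start with ≤-<-connex e t
    ... | inj₁ e≤t rewrite m≤n⇒m⊔n≡n e≤t =
      trans (start-row-≡ t≤k ts≤t e′≤t st) (cong (λ z → sum (t ∷ ts) + z) (m≤n⇒m⊓n≡m e≤t))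
    ... | inj₂ t<e rewrite m≥n⇒m⊔n≡m (<⇒≤ t<e) = start-row-> t≤k ts≤t e′≤t st t<e e≤k

  -- Here σ counts the small hooks gained. A bottom row with t small hooks gains none and forces e =
  -- e′. One with n > t has n = e and gains e - t, while the rest gains at most e′ ≤ t. So σ ≤ e,
  -- and equality forces e′ = e ⊓ t at every block.
  strip-size : ∀ {ts e κ⁺ κ μ} → Blocks ts → Strip ts e κ⁺ κ → CoreRows k κ μ →
    ∃ λ σ → sum μ ≡ sum (partition 0 ts) + σ × σ ≤ e × (σ ≡ e → κ⁺ ≡ core⁺ e ts)
  strip-size [] ([] {zero})  []               = 0 , refl , z≤n , λ _ → refl
  strip-size [] ([] {suc e}) (row∷ {n = n} _ eq []) =
    suc e , trans (+-identityʳ n) (trans (sym (+-identityʳ n)) (sym eq)) , ≤-refl , λ _ → refl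
  strip-size {t ∷ ts} {e} (block 1≤t t≤k ts≤t bs) (block {e′ = e′} e′≤t st) (row∷ {n = n} n≤k x≡ cr)
    with tail-CoreRows⁻ t≤k ts≤t e′≤t st (k ∸ t) ≤-refl cr
  ... | μ′ , refl , cr′ with strip-size bs st cr′
  ... | σ , sum≡ , σ≤e′ , tight with <-cmp n t
  ... | tri< n<t _ _ = ⊥-elim (<⇒≱ (start-row-< t≤k ts≤t e′≤t st n<t) (≤-trans (m≤m+n _ e) (≤-reflexive x≡)))
  ... | tri≈ _ refl _ with +-cancelˡ-≡ (sum (t ∷ ts)) e e′ (trans x≡ (start-row-≡ t≤k ts≤t e′≤t st))
  ... | refl = σ , total , σ≤e′ ,
    λ σ≡e → cong (λ z → (sum (t ∷ ts) + e) ∷ replicate (k ∸ t) (sum (t ∷ ts)) ++ z)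
              (trans (tight σ≡e) (cong (λ z → core⁺ z ts) (sym (m≤n⇒m⊓n≡m e′≤t))))
    where
    S = sum (replicate (k ∸ t) t)
    total : t + sum (replicate (k ∸ t) t ++ μ′) ≡ t + sum (replicate (k ∸ t) t ++ partition 0 ts) + σ
    total rewrite sum-++ (replicate (k ∸ t) t) μ′ | sum-++ (replicate (k ∸ t) t) (partition 0 ts) | sum≡ =
      lemma t S (sum (partition 0 ts)) σ
      where
      lemma : ∀ t S p σ → t + (S + (p + σ)) ≡ t + (S + p) + σ
      lemma = solve-∀
  strip-size {t ∷ ts} {e} (block 1≤t t≤k ts≤t bs) (block {e′ = e′} e′≤t st) (row∷ {n = n} n≤k x≡ cr)
      | μ′ , refl , cr′ | σ , sum≡ , σ≤e′ , tight | tri> _ _ t<n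
    with +-cancelˡ-≡ (sum (t ∷ ts)) e n (trans x≡ (start-row-> t≤k ts≤t e′≤t st t<n n≤k))
  ... | refl = σ + (n ∸ t) , total , bound , tight′
    where
    S = sum (replicate (k ∸ t) t)
    t+[n∸t] : t + (n ∸ t) ≡ n
    t+[n∸t] = m+[n∸m]≡n (<⇒≤ t<n)
    total : n + sum (replicate (k ∸ t) t ++ μ′) ≡ t + sum (replicate (k ∸ t) t ++ partition 0 ts) + (σ + (n ∸ t))
    total rewrite sum-++ (replicate (k ∸ t) t) μ′ | sum-++ (replicate (k ∸ t) t) (partition 0 ts) | sum≡ =
      trans (cong (_+ (S + (sum (partition 0 ts) + σ))) (sym t+[n∸t])) (lemma t S (sum (partition 0 ts)) σ (n ∸ t))
      where
      lemma : ∀ t S p σ d → t + d + (S + (p + σ)) ≡ t + (S + p) + (σ + d)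
      lemma = solve-∀
    bound : σ + (n ∸ t) ≤ n
    bound = ≤-trans (+-monoˡ-≤ (n ∸ t) (≤-trans σ≤e′ e′≤t)) (≤-reflexive t+[n∸t])
    tight′ : σ + (n ∸ t) ≡ n → _ ≡ core⁺ n (t ∷ ts)
    tight′ eq = cong (λ z → (sum (t ∷ ts) + n) ∷ replicate (k ∸ t) (sum (t ∷ ts)) ++ z)
      (trans (tight σ≡e′) (cong (λ z → core⁺ z ts) (trans e′≡t (sym (m≥n⇒m⊓n≡n (<⇒≤ t<n))))))
      where
      σ≡t : σ ≡ t
      σ≡t = +-cancelʳ-≡ (n ∸ t) σ t (trans eq (sym t+[n∸t]))
      e′≡t : e′ ≡ t
      e′≡t = ≤-antisym e′≤t (subst (_≤ e′) σ≡t σ≤e′)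
      σ≡e′ : σ ≡ e′
      σ≡e′ = trans σ≡t (sym e′≡t)

-- Candidate strips

-- Uniqueness is required before f is applied: the choices are distinct by construction, and f will
-- be the removal of zeros.
filter-singleton : ∀ {A B : Set} (p : B → Bool) (f : A → B) {x} xs → Unique xs → x ∈ xs → p (f x) ≡ true →
  (∀ {y} → y ∈ xs → p (f y) ≡ true → y ≡ x) → filterᵇ p (map f xs) ≡ [ f x ]
filter-singleton p f {x} (x ∷ xs) (x∉ ∷ _) (here refl) px only rewrite px = cong (f x ∷_) (none xs x∉ (only ∘ there))
  where
  none : ∀ ys → All (x ≢_) ys → (∀ {y} → y ∈ ys → p (f y) ≡ true → y ≡ x) → filterᵇ p (map f ys) ≡ []
  none []       _          _    = refl
  none (y ∷ ys) (x≢y ∷ x∉) only with p (f y) in eq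
  ... | true  = contradiction (sym (only (here refl) eq)) x≢y
  ... | false = none ys x∉ (only ∘ there)
filter-singleton p f {x} (z ∷ xs) (z∉ ∷ uniq) (there x∈) px only with p (f z) in eq
... | true  = contradiction (only (here refl) eq) (All.lookup z∉ x∈)
... | false = filter-singleton p f xs uniq x∈ px (only ∘ there)

concatMap-cartesian : ∀ {A B C : Set} (f : A → B → C) xs ys →
  concatMap (λ x → map (f x) ys) xs ≡ cartesianProductWith f xs ys
concatMap-cartesian f []       ys = refl
concatMap-cartesian f (x ∷ xs) ys = cong (map (f x) ys ++_) (concatMap-cartesian f xs ys)

Within : ℕ → ℕ → ℕ → Set
Within s x y = x ≤ y × y ≤ x + s

choices-∷ : ∀ s x xs → choices s (x ∷ xs) ≡ cartesianProductWith _∷_ (applyUpTo (λ z → x + z) (suc s)) (choices s xs)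
choices-∷ s x xs = concatMap-cartesian _∷_ (applyUpTo (λ z → x + z) (suc s)) (choices s xs)

choices-Unique : ∀ s xs → Unique (choices s xs)
choices-Unique s []       = [] ∷ []
choices-Unique s (x ∷ xs) rewrite choices-∷ s x xs =
  cartesianProductWith⁺ _∷_ (λ { refl → refl , refl })
    (applyUpTo⁺₁ (λ z → x + z) (suc s) (λ i<j _ eq → <⇒≢ i<j (+-cancelˡ-≡ x _ _ eq))) (choices-Unique s xs)

∈-choices⁺ : ∀ {s xs ys} → Pointwise (Within s) xs ys → ys ∈ choices s xs
∈-choices⁺ [] = here refl
∈-choices⁺ {s} {x ∷ xs} {y ∷ ys} ((x≤y , y≤x+s) ∷ w) rewrite choices-∷ s x xs =
  ∈-cartesianProductWith⁺ _∷_
    (subst (_∈ applyUpTo (λ z → x + z) (suc s)) (m+[n∸m]≡n x≤y)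
      (∈-applyUpTo⁺ (λ z → x + z) (s≤s (m≤n+o⇒m∸n≤o y x y≤x+s))))
    (∈-choices⁺ w)

∈-choices⁻ : ∀ {s} xs {ys} → ys ∈ choices s xs → Pointwise (Within s) xs ys
∈-choices⁻ []       (here refl) = []
∈-choices⁻ {s} (x ∷ xs) ys∈ rewrite choices-∷ s x xs
  with ∈-cartesianProductWith⁻ _∷_ (applyUpTo (λ z → x + z) (suc s)) (choices s xs) ys∈
... | y , ys , y∈ , ys∈′ , refl with ∈-applyUpTo⁻ (λ z → x + z) y∈
... | i , i<1+s , refl = (m≤m+n x i , +-monoʳ-≤ x (≤-pred i<1+s)) ∷ ∈-choices⁻ xs ys∈′

nonzero : List ℕ → List ℕ
nonzero = filterᵇ (0 <ᵇ_)

nonzero-positive : ∀ {xs} → All (0 <_) xs → nonzero xs ≡ xs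
nonzero-positive pos = filter-all _ (All.map <⇒<ᵇ pos)

nonzero-++ : ∀ {xs} → All (0 <_) xs → ∀ ys → nonzero (xs ++ ys) ≡ xs ++ nonzero ys
nonzero-++ {xs} pos ys = trans (filter-++ _ xs ys) (cong (_++ nonzero ys) (nonzero-positive pos))

-- Only the last entry can vanish, since the others dominate positive parts, and `row` is 0 past the
-- end anyway.
row-nonzero : ∀ {s xs ys} → All (0 <_) xs → Pointwise (Within s) (xs ++ [ 0 ]) ys → ∀ i → row (nonzero ys) i ≡ row ys i
row-nonzero {ys = zero ∷ []}  [] (_ ∷ []) zero          = refl
row-nonzero {ys = zero ∷ []}  [] (_ ∷ []) (suc zero)    = refl
row-nonzero {ys = zero ∷ []}  [] (_ ∷ []) (suc (suc i)) = refl
row-nonzero {ys = suc y ∷ []} [] (_ ∷ []) i             = refl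
row-nonzero {ys = zero ∷ ys}  (0<x ∷ _)   ((x≤0 , _) ∷ _) i     = contradiction x≤0 (<⇒≱ 0<x)
row-nonzero {ys = suc y ∷ ys} (_ ∷ pos)   (_ ∷ w) zero          = refl
row-nonzero {ys = suc y ∷ ys} (_ ∷ pos)   (_ ∷ w) (suc zero)    = refl
row-nonzero {ys = suc y ∷ ys} (_ ∷ pos)   (_ ∷ w) (suc (suc i)) = row-nonzero pos w (suc i)

row-beyond : ∀ κ {i} → length κ ≤ i → row κ (suc i) ≡ 0
row-beyond []      _         = refl
row-beyond (x ∷ κ) (s≤s l≤i) = row-beyond κ l≤i

Descending⇒decreasingᵇ : ∀ {κ} → Descending κ → decreasingᵇ κ ≡ true
Descending⇒decreasingᵇ []                           = refl
Descending⇒decreasingᵇ ([] ∷ [])                    = refl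
Descending⇒decreasingᵇ ((y≤x ∷ _) ∷ (y≥ ∷ desc)) =
  true-∧ (≤⇒≤ᵇ≡true y≤x) (Descending⇒decreasingᵇ (y≥ ∷ desc))

isPartitionᵇ⁺ : ∀ {κ} → Descending κ → All (0 <_) κ → isPartitionᵇ κ ≡ true
isPartitionᵇ⁺ desc pos = true-∧ (Descending⇒decreasingᵇ desc) (all⁺ _ (All.map <⇒<ᵇ≡true pos))

horizontalᵇ⁺ : ∀ τ κ → (∀ i → row τ i ≤ row κ i) → (∀ i → row κ (suc (suc i)) ≤ row τ (suc i)) → horizontalᵇ τ κ ≡ true
horizontalᵇ⁺ τ κ below above = true-∧
  (all⁺ _ (upto1-All (length τ) (λ {j} _ _ → ≤⇒≤ᵇ≡true (below j))))
  (all⁺ _ (upto1-All (length κ) (λ { {suc j} _ _ → ≤⇒≤ᵇ≡true (above j) })))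

horizontalᵇ⁻ : ∀ τ κ → horizontalᵇ τ κ ≡ true → ∀ i → row κ (suc (suc i)) ≤ row τ (suc i)
horizontalᵇ⁻ τ κ eq i with ≤-<-connex (length κ) i
... | inj₁ l≤i = subst (_≤ row τ (suc i)) (sym (row-beyond κ (m≤n⇒m≤1+n l≤i))) z≤n
... | inj₂ i<l = ≤ᵇ≡true⇒≤ (row κ (suc (suc i))) (row τ (suc i))
  (upto1-All⁻ (length κ) (all⁻ _ (upto1 (length κ)) (proj₂ (∧-true eq))) (s≤s z≤n) i<l)

row-replicate-mono : ∀ n {x κ κ′} → (∀ i → row κ i ≤ row κ′ i) →
  ∀ i → row (replicate n x ++ κ) i ≤ row (replicate n x ++ κ′) i
row-replicate-mono zero    le i             = le i
row-replicate-mono (suc n) le zero          = z≤n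
row-replicate-mono (suc n) le (suc zero)    = ≤-refl
row-replicate-mono (suc n) le (suc (suc i)) = row-replicate-mono n le (suc i)

row-replicate-interlace : ∀ n {x κ κ′} → row κ′ 1 ≤ x → (∀ i → row κ′ (suc (suc i)) ≤ row κ (suc i)) →
  ∀ i → row (replicate n x ++ κ′) (suc i) ≤ row (x ∷ replicate n x ++ κ) (suc i)
row-replicate-interlace zero    first le zero    = first
row-replicate-interlace zero    first le (suc i) = le i
row-replicate-interlace (suc n) first le zero    = ≤-refl
row-replicate-interlace (suc n) first le (suc i) = row-replicate-interlace n first le i

-- Inside a block a row is squeezed: containment makes it at least W, and the horizontal condition
-- at most the row below it in the old core, again W.
tail-choices : ∀ {s W xs xs′ ys} n → Pointwise (Within s) (replicate n W ++ xs) ys →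
  (∀ i → row ys (suc i) ≤ row (W ∷ replicate n W ++ xs′) (suc i)) →
  ∃ λ ys′ → ys ≡ replicate n W ++ ys′ × Pointwise (Within s) xs ys′ × row ys′ 1 ≤ W ×
            (∀ i → row ys′ (suc (suc i)) ≤ row xs′ (suc i))
tail-choices zero w le = _ , refl , w , le 0 , λ i → le (suc i)
tail-choices (suc n) ((W≤y , _) ∷ w) le with tail-choices n w (λ i → le (suc i))
... | ys′ , refl , rest = ys′ , cong (_∷ _) (≤-antisym (le 0) W≤y) , rest

module _ (k : ℕ) where

  core⁺-zero : ∀ ts → core k 0 ts ++ [ 0 ] ≡ core⁺ k 0 ts
  core⁺-zero []       = refl
  core⁺-zero (t ∷ ts) = cong (_ ∷_)
    (trans (++-assoc (replicate (k ∸ t) (sum (t ∷ ts))) (core k 0 ts) [ 0 ])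
           (cong (replicate (k ∸ t) (sum (t ∷ ts)) ++_) (core⁺-zero ts)))

  top-positive : ∀ e → All (0 <_) (top e)
  top-positive zero    = []
  top-positive (suc e) = s≤s z≤n ∷ []

  strip-positive : ∀ {ts e κ⁺ κ} → Blocks k ts → Strip k ts e κ⁺ κ → All (0 <_) κ
  strip-positive []                  ([] {e})     = top-positive e
  strip-positive (block 1≤t _ _ bs) (block {t} {ts} _ st) =
    ≤-trans 1≤t (≤-trans (m≤m+n t (sum ts)) (m≤m+n _ _)) ∷
    ++⁺ (replicate⁺ (k ∸ t) (≤-trans 1≤t (m≤m+n t (sum ts)))) (strip-positive bs st)

  strip-nonzero : ∀ {ts e κ⁺ κ} → Blocks k ts → Strip k ts e κ⁺ κ → nonzero κ⁺ ≡ κ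
  strip-nonzero []                  ([] {zero})  = refl
  strip-nonzero []                  ([] {suc e}) = refl
  strip-nonzero b@(block 1≤t _ _ bs) s@(block {t} {ts} {e} {κ⁺ = κ⁺} {κ = κ} _ st)
    with strip-positive b s
  ... | pos = trans (nonzero-++ {sum (t ∷ ts) + e ∷ replicate (k ∸ t) (sum (t ∷ ts))} (++⁻ˡ _ pos) κ⁺)
                    (cong (((sum (t ∷ ts) + e) ∷ replicate (k ∸ t) (sum (t ∷ ts))) ++_) (strip-nonzero bs st))

  core-positive : ∀ {ts} → Blocks k ts → ∀ e → All (0 <_) (core k e ts)
  core-positive {ts} bs e = strip-positive bs (core-strip k ts e)

  core-desc : ∀ ts e → Descending (core k e ts)
  core-desc ts e = strip-desc k (core-strip k ts e)

  partition-positive : ∀ {ts} → Blocks k ts → ∀ e → All (0 <_) (partition k e ts)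
  partition-positive []                         e = top-positive e
  partition-positive {t ∷ ts} (block 1≤t _ _ bs) e =
    ≤-trans 1≤t (m≤n⊔m e t) ∷ ++⁺ (replicate⁺ (k ∸ t) 1≤t) (partition-positive bs (e ⊓ t))

  𝔭-core : ∀ {ts} → Blocks k ts → ∀ {e} → e ≤ k → 𝔭 k (core k e ts) ≡ partition k e ts
  𝔭-core {ts} bs {e} e≤k = trans
    (cong nonzero (CoreRows⇒pRows k (core-desc ts e) (core-CoreRows k bs e≤k)))
    (nonzero-positive (partition-positive bs e))

  -- The exchange preserves the total, as (e ⊔ t) + (e ⊓ t) = e + t. This gives the strip its size.
  sum-partition : ∀ ts e → sum (partition k e ts) ≡ sum (partition k 0 ts) + e
  sum-partition [] zero    = refl
  sum-partition [] (suc e) = +-identityʳ (suc e)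
  sum-partition (t ∷ ts) e
    rewrite sum-++ (replicate (k ∸ t) t) (partition k (e ⊓ t) ts) | sum-++ (replicate (k ∸ t) t) (partition k 0 ts)
          | sum-partition ts (e ⊓ t)
    = begin
      (e ⊔ t) + (S + (p + (e ⊓ t)))   ≡⟨ lemma (e ⊔ t) S p (e ⊓ t) ⟩
      S + p + ((e ⊔ t) + (e ⊓ t))     ≡⟨ cong (λ z → S + p + z) (max+min (≤-total e t)) ⟩
      S + p + (t + e)                 ≡⟨ lemma′ t S p e ⟩
      t + (S + p) + e                 ∎
    where
    open ≡-Reasoning
    S = sum (replicate (k ∸ t) t)
    p = sum (partition k 0 ts)
    lemma : ∀ x S p y → x + (S + (p + y)) ≡ S + p + (x + y)
    lemma = solve-∀
    lemma′ : ∀ t S p e → S + p + (t + e) ≡ t + (S + p) + e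
    lemma′ = solve-∀
    max+min : (e ≤ t) ⊎ (t ≤ e) → (e ⊔ t) + (e ⊓ t) ≡ t + e
    max+min (inj₁ e≤t) rewrite m≤n⇒m⊔n≡n e≤t | m≤n⇒m⊓n≡m e≤t = refl
    max+min (inj₂ t≤e) rewrite m≥n⇒m⊔n≡m t≤e | m≥n⇒m⊓n≡n t≤e = +-comm e t

  core-isCore : ∀ {ts} → Blocks k ts → ∀ {e} → e ≤ k → isCoreᵇ k (core k e ts) ≡ true
  core-isCore {ts} bs {e} e≤k = CoreRows⇒core k (core-desc ts e) (core-CoreRows k bs e≤k)

  core-isPartition : ∀ {ts} → Blocks k ts → ∀ e → isPartitionᵇ (core k e ts) ≡ true
  core-isPartition {ts} bs e = isPartitionᵇ⁺ (core-desc ts e) (core-positive bs e)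

  size<-CoreRows : ∀ {κ μ} → Descending κ → CoreRows k κ μ → size< k κ ≡ sum μ
  size<-CoreRows {κ} desc cr = trans (size<-pRows k κ) (cong sum (CoreRows⇒pRows k desc cr))

  size<-core : ∀ {ts} → Blocks k ts → ∀ {e} → e ≤ k → size< k (core k e ts) ≡ sum (partition k e ts)
  size<-core {ts} bs {e} e≤k = size<-CoreRows (core-desc ts e) (core-CoreRows k bs e≤k)

  core-mono : ∀ ts e i → row (core k 0 ts) i ≤ row (core k e ts) i
  core-mono []       e i             = z≤n
  core-mono (t ∷ ts) e zero          = z≤n
  core-mono (t ∷ ts) e (suc zero)    = +-monoʳ-≤ (sum (t ∷ ts)) z≤n
  core-mono (t ∷ ts) e (suc (suc i)) = row-replicate-mono (k ∸ t) (core-mono ts (e ⊓ t)) (suc i)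

  core-above≤ : ∀ t ts e → row (core k (e ⊓ t) ts) 1 ≤ sum (t ∷ ts)
  core-above≤ t ts e = row-All (strip-above≤ k (m⊓n≤n e t) (core-strip k ts (e ⊓ t))) 1

  core-interlace : ∀ ts e i → row (core k e ts) (suc (suc i)) ≤ row (core k 0 ts) (suc i)
  core-interlace []       e i = ≤-reflexive (row-top-2+ k e i)
  core-interlace (t ∷ ts) e i rewrite +-identityʳ (sum (t ∷ ts)) =
    row-replicate-interlace (k ∸ t) (core-above≤ t ts e) (core-interlace ts (e ⊓ t)) i

  replicate-within : ∀ {s x xs ys} n → Pointwise (Within s) xs ys →
    Pointwise (Within s) (replicate n x ++ xs) (replicate n x ++ ys)
  replicate-within zero    w = w
  replicate-within (suc n) w = (≤-refl , m≤m+n _ _) ∷ replicate-within n w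

  core⁺-within : ∀ {s} ts {e} → e ≤ s → Pointwise (Within s) (core⁺ k 0 ts) (core⁺ k e ts)
  core⁺-within []           e≤s = (z≤n , e≤s) ∷ []
  core⁺-within {s} (t ∷ ts) {e} e≤s =
    ( +-monoʳ-≤ (sum (t ∷ ts)) z≤n
    , subst (λ z → sum (t ∷ ts) + e ≤ z + s) (sym (+-identityʳ _)) (+-monoʳ-≤ (sum (t ∷ ts)) e≤s)) ∷
    replicate-within (k ∸ t) (core⁺-within ts (≤-trans (m⊓n≤m e t) e≤s))

  strip⁺-row-1 : ∀ {ts e κ⁺ κ} → Strip k ts e κ⁺ κ → row κ⁺ 1 ≡ sum ts + e
  strip⁺-row-1 []          = refl
  strip⁺-row-1 (block _ _) = refl

  choices⇒Strip : ∀ {s} ts {ys} → Pointwise (Within s) (core⁺ k 0 ts) ys →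
    (∀ i → row ys (suc (suc i)) ≤ row (core k 0 ts) (suc i)) →
    ∃₂ λ e κ → Strip k ts e ys κ × e ≤ s
  choices⇒Strip []       ((_ , y≤s) ∷ []) le = _ , _ , [] , y≤s
  choices⇒Strip {s} (t ∷ ts) ((W≤y , y≤) ∷ w) le rewrite +-identityʳ (sum (t ∷ ts))
    with tail-choices (k ∸ t) w le
  ... | ys′ , refl , w′ , first , le′ with choices⇒Strip ts w′ le′ | m≤n⇒∃[o]m+o≡n W≤y
  ... | e′ , κ , st , _ | e , refl =
    e , _ , block e′≤t st , +-cancelˡ-≤ (sum (t ∷ ts)) e s y≤
    where
    e′≤t : e′ ≤ t
    e′≤t = +-cancelˡ-≤ (sum ts) e′ t (subst₂ _≤_ (strip⁺-row-1 st) (+-comm t (sum ts)) first)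

-- Residues

T⇒≡true : ∀ {b} → T b → b ≡ true
T⇒≡true = Equivalence.to T-≡

≡true⇒T : ∀ {b} → b ≡ true → T b
≡true⇒T = Equivalence.from T-≡

∈-filterᵇ⁺ : ∀ {A : Set} (p : A → Bool) {x xs} → x ∈ xs → p x ≡ true → x ∈ filterᵇ p xs
∈-filterᵇ⁺ p x∈ px = ∈-filter⁺ (T? ∘ p) x∈ (≡true⇒T px)

∈-filterᵇ⁻ : ∀ {A : Set} (p : A → Bool) {x xs} → x ∈ filterᵇ p xs → x ∈ xs × p x ≡ true
∈-filterᵇ⁻ p {xs = xs} x∈ with ∈-filter⁻ (T? ∘ p) {xs = xs} x∈
... | x∈xs , px = x∈xs , T⇒≡true px

#distinct-unique : ∀ xs {ys} → Unique ys → (∀ {x} → x ∈ xs → x ∈ ys) → (∀ {y} → y ∈ ys → y ∈ xs) →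
  #distinct xs ≡ length ys
#distinct-unique xs uniq ⊆ ⊇ = ↭-length (∼bag⇒↭ (unique∧set⇒bag (deduplicate-! xs) uniq
  (mk⇔ (⊆ ∘ Equivalence.from (deduplicate-∈⇔ _≟_)) (Equivalence.to (deduplicate-∈⇔ _≟_) ∘ ⊇))))

∈-cellsFrom⁺ : ∀ κ o i {j} → 1 ≤ j → j ≤ row κ (suc i) → (suc (o + i) , j) ∈ cellsFrom (suc o) κ
∈-cellsFrom⁺ []      o i 1≤j j≤0 = contradiction j≤0 (<⇒≱ 1≤j)
∈-cellsFrom⁺ (x ∷ κ) o zero {suc j} 1≤j j≤x rewrite +-identityʳ o =
  ∈-++⁺ˡ (∈-map⁺ (suc o ,_) (∈-applyUpTo⁺ suc j≤x))
∈-cellsFrom⁺ (x ∷ κ) o (suc i) 1≤j j≤r rewrite +-suc o i =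
  ∈-++⁺ʳ (map (suc o ,_) (upto1 x)) (∈-cellsFrom⁺ κ (suc o) i 1≤j j≤r)

∈-cells⁺ : ∀ κ i {j} → 1 ≤ j → j ≤ row κ (suc i) → (suc i , j) ∈ cells κ
∈-cells⁺ κ i = ∈-cellsFrom⁺ κ 0 i

data Cell (κ : List ℕ) (o : ℕ) : ℕ × ℕ → Set where
  cell : ∀ i {j} → 1 ≤ j → j ≤ row κ (suc i) → Cell κ o (suc (o + i) , j)

∈-cellsFrom⁻ : ∀ κ o {c} → c ∈ cellsFrom (suc o) κ → Cell κ o c
∈-cellsFrom⁻ (x ∷ κ) o c∈ with ∈-++⁻ (map (suc o ,_) (upto1 x)) c∈
... | inj₂ c∈′ with ∈-cellsFrom⁻ κ (suc o) c∈′
...   | cell i 1≤j j≤r rewrite sym (+-suc o i) = cell (suc i) 1≤j j≤r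
∈-cellsFrom⁻ (x ∷ κ) o c∈ | inj₁ c∈′ with ∈-map⁻ (suc o ,_) c∈′
... | _ , j∈ , refl with ∈-applyUpTo⁻ suc j∈
... | j , j<x , refl = subst (λ z → Cell (x ∷ κ) o (suc z , suc j)) (+-identityʳ o) (cell 0 (s≤s z≤n) j<x)

∉ᵇ⁺ : ∀ κ i j → row κ i < j → not (memᵇ κ i j) ≡ true
∉ᵇ⁺ κ zero    j r<j = refl
∉ᵇ⁺ κ (suc i) j r<j rewrite <⇒≤ᵇ≡false r<j with 1 ≤ᵇ j
... | true  = refl
... | false = refl

∉ᵇ⁻ : ∀ κ i {j} → 1 ≤ j → not (memᵇ κ (suc i) j) ≡ true → row κ (suc i) < j
∉ᵇ⁻ κ i {j} 1≤j eq with row κ (suc i) <? j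
... | yes r<j = r<j
... | no  r≮j rewrite ≤⇒≤ᵇ≡true 1≤j | ≤⇒≤ᵇ≡true (≮⇒≥ r≮j) = contradiction eq λ ()

mod-cancel : ∀ n .{{_ : NonZero n}} a d → d < n → (a + d) % n ≡ a % n → d ≡ 0
mod-cancel n a d d<n eq = case (<-≤-connex (b + d) n)
  where
  b = a % n
  eq′ : (b + d) % n ≡ b
  eq′ = trans (sym (trans (%-distribˡ-+ a d n) (cong (λ z → (b + z) % n) (m<n⇒m%n≡m d<n)))) eq
  case : (b + d < n) ⊎ (n ≤ b + d) → d ≡ 0
  case (inj₁ lt) = +-cancelˡ-≡ b d 0 (trans (trans (sym (m<n⇒m%n≡m lt)) eq′) (sym (+-identityʳ b)))
  case (inj₂ ge) = contradiction (+-cancelˡ-≡ b d n (trans (sym (m∸n+n≡m ge)) (cong (_+ n) wrapped))) (<⇒≢ d<n)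
    where
    wrapped : b + d ∸ n ≡ b
    wrapped = trans (sym (m<n⇒m%n≡m (m<n+o⇒m∸n<o (b + d) n (+-mono-< (m%n<n a n) d<n))))
                    (trans (m≤n⇒[n∸m]%m≡n%m ge) eq′)

mod-injective : ∀ n .{{_ : NonZero n}} a {d e} → d < n → e < n → (a + d) % n ≡ (a + e) % n → d ≡ e
mod-injective n a {d} {e} d<n e<n eq = case (≤-total d e)
  where
  ordered : ∀ {d e} → d ≤ e → e < n → (a + e) % n ≡ (a + d) % n → d ≡ e
  ordered {d} {e} d≤e e<n eq with m≤n⇒∃[o]m+o≡n d≤e
  ... | o , refl = sym (trans (cong (λ z → d + z) (mod-cancel n (a + d) o (≤-<-trans (m≤n+m o d) e<n)
                     (trans (cong (_% n) (+-assoc a d o)) eq))) (+-identityʳ d))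
  case : (d ≤ e) ⊎ (e ≤ d) → d ≡ e
  case (inj₁ d≤e) = ordered d≤e e<n (sym eq)
  case (inj₂ e≤d) = sym (ordered e≤d d<n eq)

residue-injective : ∀ k i a {d e} → d ≤ k → e ≤ k → residue k (i , a + d) ≡ residue k (i , a + e) → d ≡ e
residue-injective k i a {d} {e} d≤k e≤k eq = mod-injective (suc k) (a + k * i) (s≤s d≤k) (s≤s e≤k)
  (trans (cong (_% suc k) (swap a (k * i) d)) (trans eq (cong (_% suc k) (sym (swap a (k * i) e)))))
  where
  swap : ∀ a b d → a + b + d ≡ a + d + b
  swap = solve-∀

residue-shift-cong : ∀ k t i j i′ j′ → residue k (i , j) ≡ residue k (i′ , j′) →
  residue k (i , t + j) ≡ residue k (i′ , t + j′)
residue-shift-cong k t i j i′ j′ eq = begin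
  (t + j + k * i) % suc k               ≡⟨ cong (_% suc k) (+-assoc t j (k * i)) ⟩
  (t + (j + k * i)) % suc k             ≡⟨ %-distribˡ-+ t (j + k * i) (suc k) ⟩
  (t % suc k + residue k (i , j)) % suc k    ≡⟨ cong (λ z → (t % suc k + z) % suc k) eq ⟩
  (t % suc k + residue k (i′ , j′)) % suc k  ≡⟨ %-distribˡ-+ t (j′ + k * i′) (suc k) ⟨
  (t + (j′ + k * i′)) % suc k           ≡⟨ cong (_% suc k) (+-assoc t j′ (k * i′)) ⟨
  (t + j′ + k * i′) % suc k             ∎
  where open ≡-Reasoning

-- k (k + 1 - t) ≡ t mod k + 1
residue-block : ∀ k {t} → t ≤ k → ∀ i j → residue k (suc ((k ∸ t) + i) , j) ≡ residue k (i , t + j)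
residue-block k {t} t≤k i j with m≤n⇒∃[o]m+o≡n t≤k
... | u , refl rewrite m+n∸m≡n t u = trans (cong (_% suc (t + u)) (lemma t u i j))
                                           ([m+kn]%n≡m%n (t + j + (t + u) * i) u (suc (t + u)))
  where
  lemma : ∀ t u i j → j + (t + u) * suc (u + i) ≡ t + j + (t + u) * i + u * suc (t + u)
  lemma = solve-∀

residue-below-block : ∀ k {t} → t ≤ k → ∀ i j S i′ d → residue k (suc i , j) ≡ residue k (i′ , S + d) →
  residue k (suc (suc ((k ∸ t) + i)) , j) ≡ residue k (i′ , t + S + d)
residue-below-block k {t} t≤k i j S i′ d eq = begin
  residue k (suc (suc ((k ∸ t) + i)) , j)    ≡⟨ cong (λ z → residue k (suc z , j)) (sym (+-suc (k ∸ t) i)) ⟩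
  residue k (suc ((k ∸ t) + suc i) , j)      ≡⟨ residue-block k t≤k (suc i) j ⟩
  residue k (suc i , t + j)                  ≡⟨ residue-shift-cong k t (suc i) j i′ (S + d) eq ⟩
  residue k (i′ , t + (S + d))               ≡⟨ cong (λ z → residue k (i′ , z)) (sym (+-assoc t S d)) ⟩
  residue k (i′ , t + S + d)                 ∎
  where open ≡-Reasoning

module _ (k : ℕ) where

  -- The overhangs of all rows begin at cells of equal residue, so the added cell at offset d of any
  -- row repeats the residue at offset d of the bottom row.
  strip-residue : ∀ {ts} → Blocks k ts → ∀ {e} i {j} → row (core k 0 ts) (suc i) < j → j ≤ row (core k e ts) (suc i) →
    ∃ λ d → d < e × residue k (suc i , j) ≡ residue k (1 , sum ts + suc d)
  strip-residue [] {e} zero {suc j} _ j≤e = j , subst (suc j ≤_) (row-top-1 k e) j≤e , refl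
  strip-residue [] {e} (suc i) 0<j j≤0 = contradiction (subst (_ ≤_) (row-top-2+ k e i) j≤0) (<⇒≱ 0<j)
  strip-residue {t ∷ ts} (block _ t≤k _ bs) {e} zero W<j j≤W+e with m<n⇒∃[o]m+o≡n W<j
    where
    m<n⇒∃[o]m+o≡n : ∀ {m n} → m + 0 < n → ∃ λ d → m + suc d ≡ n
    m<n⇒∃[o]m+o≡n {m} lt with m≤n⇒∃[o]m+o≡n lt
    ... | d , eq = d , trans (+-suc m d) (trans (cong (λ z → suc (z + d)) (sym (+-identityʳ m))) eq)
  ... | d , refl = d , +-cancelˡ-≤ (sum (t ∷ ts)) (suc d) e j≤W+e , refl
  strip-residue {t ∷ ts} (block _ t≤k _ bs) {e} (suc i) {j} r<j j≤r with <-≤-connex i (k ∸ t)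
  ... | inj₁ i<h rewrite row-replicate-< (sum (t ∷ ts)) (core k 0 ts) i<h
                       | row-replicate-< (sum (t ∷ ts)) (core k (e ⊓ t) ts) i<h = contradiction j≤r (<⇒≱ r<j)
  ... | inj₂ h≤i with m≤n⇒∃[o]m+o≡n h≤i
  ...   | i′ , refl rewrite row-replicate-≥ (k ∸ t) i′ (sum (t ∷ ts)) (core k 0 ts)
                          | row-replicate-≥ (k ∸ t) i′ (sum (t ∷ ts)) (core k (e ⊓ t) ts)
    with strip-residue bs i′ r<j j≤r
  ... | d , d<e⊓t , eq = d , <-≤-trans d<e⊓t (m⊓n≤m e t) , residue-below-block k t≤k i′ j (sum ts) 1 (suc d) eq

  -- The bottom row shows s consecutive residues, distinct because s ≤ k, and the other rows only
  -- repeat them.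
  #distinct-strip : ∀ {ts} → Blocks k ts → ∀ {s} → s ≤ k →
    #distinct (map (residue k) (skewCells (core k s ts) (core k 0 ts))) ≡ s
  #distinct-strip {ts} bs {s} s≤k = trans
    (#distinct-unique (map (residue k) (skewCells (core k s ts) (core k 0 ts))) uniq ⊆ ⊇)
    (length-applyUpTo f s)
    where
    f : ℕ → ℕ
    f d = residue k (1 , sum ts + suc d)
    uniq : Unique (applyUpTo f s)
    uniq = applyUpTo⁺₁ f s (λ i<j j<s eq → <⇒≢ i<j (suc-injective
      (residue-injective k 1 (sum ts) (≤-trans i<j (≤-trans (<⇒≤ j<s) s≤k)) (≤-trans j<s s≤k) eq)))
    ⊆ : ∀ {x} → x ∈ map (residue k) (skewCells (core k s ts) (core k 0 ts)) → x ∈ applyUpTo f s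
    ⊆ x∈ with ∈-map⁻ (residue k) x∈
    ... | c , c∈ , refl with ∈-filterᵇ⁻ _ {xs = cells (core k s ts)} c∈
    ... | c∈′ , out with ∈-cellsFrom⁻ (core k s ts) 0 c∈′
    ... | cell i 1≤j j≤r with strip-residue bs i (∉ᵇ⁻ (core k 0 ts) i 1≤j out) j≤r
    ... | d , d<s , eq = subst (_∈ applyUpTo f s) (sym eq) (∈-applyUpTo⁺ f d<s)
    ⊇ : ∀ {y} → y ∈ applyUpTo f s → y ∈ map (residue k) (skewCells (core k s ts) (core k 0 ts))
    ⊇ y∈ with ∈-applyUpTo⁻ f y∈
    ... | d , d<s , refl = ∈-map⁺ (residue k) (∈-filterᵇ⁺ _
      (∈-cells⁺ (core k s ts) 0 (m<n⇒0<n (m<m+n (sum ts) (s≤s z≤n)))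
        (subst (sum ts + suc d ≤_) (sym (strip-row-1 k (core-strip k ts s))) (+-monoʳ-≤ (sum ts) d<s)))
      (∉ᵇ⁺ (core k 0 ts) 1 (sum ts + suc d)
        (subst (_< sum ts + suc d) (sym (strip-row-1 k (core-strip k ts 0))) (+-monoʳ-< (sum ts) (s≤s z≤n)))))

  -- The corner ends row k + 1 - t, and -(k + 1 - t) is t modulo k + 1. The fictitious row 0 lets a
  -- column alone stand for a residue.
  own-corner-residue : ∀ {t} ts → t ≤ k → residue k (suc (k ∸ t) , sum (t ∷ ts)) ≡ residue k (0 , sum (t ∷ ts) + t)
  own-corner-residue {t} ts t≤k = begin
    residue k (suc (k ∸ t) , W)        ≡⟨ cong (λ z → residue k (suc z , W)) (sym (+-identityʳ (k ∸ t))) ⟩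
    residue k (suc ((k ∸ t) + 0) , W)  ≡⟨ residue-block k t≤k 0 W ⟩
    residue k (0 , t + W)              ≡⟨ cong (λ z → residue k (0 , z)) (+-comm t W) ⟩
    residue k (0 , W + t)              ∎
    where
    open ≡-Reasoning
    W = sum (t ∷ ts)

  block-row : ∀ t ts i → i ≤ k ∸ t → row (core k 0 (t ∷ ts)) (suc i) ≡ sum (t ∷ ts)
  block-row t ts zero    _   = +-identityʳ (sum (t ∷ ts))
  block-row t ts (suc i) i<h = row-replicate-< (sum (t ∷ ts)) (core k 0 ts) i<h

  row-below-block : ∀ t ts e i → row (core k e (t ∷ ts)) (suc (suc ((k ∸ t) + i))) ≡ row (core k (e ⊓ t) ts) (suc i)
  row-below-block t ts e i = row-replicate-≥ (k ∸ t) i (sum (t ∷ ts)) (core k (e ⊓ t) ts)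

  row-below-block-2 : ∀ t ts e i →
    row (core k e (t ∷ ts)) (suc (suc (suc ((k ∸ t) + i)))) ≡ row (core k (e ⊓ t) ts) (suc (suc i))
  row-below-block-2 t ts e i =
    trans (cong (λ z → row (core k e (t ∷ ts)) (suc (suc z))) (sym (+-suc (k ∸ t) i))) (row-below-block t ts e (suc i))

  start-of-tail : ∀ t ts e → row (core k e (t ∷ ts)) (suc (suc (k ∸ t))) ≡ sum ts + (e ⊓ t)
  start-of-tail t ts e = trans (cong (λ z → row (core k e (t ∷ ts)) (suc (suc z))) (sym (+-identityʳ (k ∸ t))))
    (trans (row-below-block t ts e 0) (strip-row-1 k (core-strip k ts (e ⊓ t))))

  -- Inside a block the row above is equally long. At its end the row above has length
  -- `sum ts + (e ⊓ t)`, short of the corner only if e < t. For a block t′ further up the carried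
  -- value is e ⊓ t, and t′ ≤ t turns e ⊓ t < t′ into e < t′.
  corner-residue : ∀ {ts} → Blocks k ts → ∀ e i → row (core k e ts) (suc (suc i)) < row (core k 0 ts) (suc i) →
    ∃ λ t → t ∈ ts × e < t × residue k (suc i , row (core k 0 ts) (suc i)) ≡ residue k (0 , sum ts + t)
  corner-residue [] e i lt = contradiction lt λ ()
  corner-residue {t ∷ ts} (block _ t≤k ts≤t bs) e i lt with <-cmp i (k ∸ t)
  ... | tri< i<h _ _ rewrite block-row t ts i (<⇒≤ i<h) | row-replicate-< (sum (t ∷ ts)) (core k (e ⊓ t) ts) i<h =
    contradiction lt (<-irrefl refl)
  ... | tri≈ _ refl _ rewrite block-row t ts i ≤-refl = t , here refl , e<t , own-corner-residue ts t≤k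
    where
    e<t : e < t
    e<t = ≰⇒> λ t≤e → <-irrefl refl (subst₂ _<_ (start-of-tail t ts e) (trans (+-comm t (sum ts)) (cong (λ z → sum ts + z) (sym (m≥n⇒m⊓n≡n t≤e)))) lt)
  ... | tri> _ _ h<i with m≤n⇒∃[o]m+o≡n h<i
  ...   | i′ , refl with corner-residue bs (e ⊓ t) i′ (subst₂ _<_ (row-below-block-2 t ts e i′) (row-below-block t ts 0 i′) lt)
  ...     | t′ , t′∈ts , e⊓t<t′ , eq = t′ , there t′∈ts , e<t′ ,
    trans (cong (λ z → residue k (suc (suc ((k ∸ t) + i′)) , z)) (row-below-block t ts 0 i′)) (residue-below-block k t≤k i′ (row (core k 0 ts) (suc i′)) (sum ts) 0 t′ eq)
    where
    e<t′ : e < t′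
    e<t′ with ⊓-sel e t
    ... | inj₁ e≡ = subst (_< t′) e≡ e⊓t<t′
    ... | inj₂ t≡ = contradiction (All.lookup ts≤t t′∈ts) (<⇒≱ (subst (_< t′) t≡ e⊓t<t′))

  corner-residue⁻ : ∀ {ts} → Blocks k ts → ∀ e {t} → t ∈ ts → e < t →
    ∃ λ i → row (core k e ts) (suc (suc i)) < row (core k 0 ts) (suc i) ×
            residue k (suc i , row (core k 0 ts) (suc i)) ≡ residue k (0 , sum ts + t)
  corner-residue⁻ {t ∷ ts} (block _ t≤k _ bs) e (here refl) e<t = k ∸ t , low , corner
    where
    low : row (core k e (t ∷ ts)) (suc (suc (k ∸ t))) < row (core k 0 (t ∷ ts)) (suc (k ∸ t))
    low rewrite block-row t ts (k ∸ t) ≤-refl | start-of-tail t ts e | m≤n⇒m⊓n≡m (<⇒≤ e<t) | +-comm t (sum ts) = +-monoʳ-< (sum ts) e<t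
    corner : residue k (suc (k ∸ t) , row (core k 0 (t ∷ ts)) (suc (k ∸ t))) ≡ residue k (0 , sum (t ∷ ts) + t)
    corner rewrite block-row t ts (k ∸ t) ≤-refl = own-corner-residue ts t≤k
  corner-residue⁻ {t ∷ ts} (block _ t≤k _ bs) e {t′} (there t′∈ts) e<t′
    with corner-residue⁻ bs (e ⊓ t) t′∈ts (≤-<-trans (m⊓n≤m e t) e<t′)
  ... | i , lt , eq = suc ((k ∸ t) + i) ,
    subst₂ _<_ (sym (row-below-block-2 t ts e i)) (sym (row-below-block t ts 0 i)) lt ,
    trans (cong (λ z → residue k (suc (suc ((k ∸ t) + i)) , z)) (row-below-block t ts 0 i)) (residue-below-block k t≤k i (row (core k 0 ts) (suc i)) (sum ts) 0 t′ eq)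

  -- Copies of one rectangle share their corner residue, so what is counted is the number of v with
  -- s < t_v; different t_v ≤ k give different residues.
  #distinct-corners : ∀ {ts} → Blocks k ts → ∀ m (t : Fin m → ℕ) → (∀ v → t v ≤ k) → (∀ v w → t v ≡ t w → v ≡ w) →
    (∀ {x} → x ∈ ts → ∃ λ v → x ≡ t v) → (∀ v → t v ∈ ts) → ∀ s →
    rBlock k (core k s ts) (core k 0 ts) ≡ α m t (suc s)
  #distinct-corners {ts} bs m t t≤k inj ts⊆ ⊆ts s =
    trans (#distinct-unique (map (residue k) corners) uniq ⊆ ⊇) (length-map f unblocked)
    where
    κ = core k s ts
    τ = core k 0 ts
    corners = filterᵇ (λ { (i , j) → not (memᵇ κ (suc i) j) }) (removableCorners τ)
    unblocked = filterᵇ (λ v → suc s ≤ᵇ t v) (allFin m)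
    f : Fin m → ℕ
    f v = residue k (0 , sum ts + t v)
    uniq : Unique (map f unblocked)
    uniq = map⁺ (λ {v} {w} eq → inj v w (residue-injective k 0 (sum ts) (t≤k v) (t≤k w) eq))
                (filter⁺ (T? ∘ λ v → suc s ≤ᵇ t v) (allFin⁺ m))
    ⊆ : ∀ {x} → x ∈ map (residue k) corners → x ∈ map f unblocked
    ⊆ x∈ with ∈-map⁻ (residue k) x∈
    ... | c , c∈ , refl with ∈-filterᵇ⁻ _ {xs = removableCorners τ} c∈
    ... | c∈′ , free with ∈-filterᵇ⁻ _ {xs = cells τ} c∈′
    ... | c∈″ , end with ∈-cellsFrom⁻ τ 0 c∈″
    ... | cell i 1≤j j≤r with ≤-antisym j≤r (≤-pred (∉ᵇ⁻ τ i (s≤s z≤n) (proj₂ (∧-true end))))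
    ... | refl with corner-residue bs s i (∉ᵇ⁻ κ (suc i) 1≤j free)
    ... | t′ , t′∈ts , s<t′ , eq with ts⊆ t′∈ts
    ... | v , refl = subst (_∈ map f unblocked) (sym eq) (∈-map⁺ f (∈-filterᵇ⁺ _ (∈-allFin v) (≤⇒≤ᵇ≡true s<t′)))
    ⊇ : ∀ {y} → y ∈ map f unblocked → y ∈ map (residue k) corners
    ⊇ y∈ with ∈-map⁻ f y∈
    ... | v , v∈ , refl with ∈-filterᵇ⁻ _ {xs = allFin m} v∈
    ... | _ , s<tv with corner-residue⁻ bs s (⊆ts v) (≤ᵇ≡true⇒≤ (suc s) (t v) s<tv)
    ... | i , lt , eq = subst (_∈ map (residue k) corners) eq (∈-map⁺ (residue k)
      (∈-filterᵇ⁺ _ (∈-filterᵇ⁺ _ (∈-cells⁺ τ i (m<n⇒0<n lt) ≤-refl)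
        -- The row above in τ is no longer than in κ, so a row end left unblocked by κ is a
        -- removable corner of τ.
        (true-∧ (∉ᵇ⁺ τ (suc (suc i)) r (≤-<-trans (core-mono k ts s (suc (suc i))) lt)) (∉ᵇ⁺ τ (suc i) (suc r) ≤-refl)))
        (∉ᵇ⁺ κ (suc (suc i)) r lt)))
      where r = row τ (suc i)

-- The weak strips on the core of P

weakStripᵇ⁺ : ∀ k τ κ s → isPartitionᵇ τ ≡ true → isCoreᵇ k τ ≡ true → isPartitionᵇ κ ≡ true → isCoreᵇ k κ ≡ true →
  horizontalᵇ τ κ ≡ true → size< k κ ≡ size< k τ + s → #distinct (map (residue k) (skewCells κ τ)) ≡ s →
  weakStripᵇ k τ κ s ≡ true
weakStripᵇ⁺ k τ κ s pτ cτ pκ cκ hor size dist =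
  true-∧ pτ (true-∧ cτ (true-∧ pκ (true-∧ cκ (true-∧ hor (true-∧ (≡⇒≡ᵇ≡true size) (≡⇒≡ᵇ≡true dist))))))

weakStripᵇ⁻ : ∀ k τ κ s → weakStripᵇ k τ κ s ≡ true →
  isCoreᵇ k κ ≡ true × horizontalᵇ τ κ ≡ true × size< k κ ≡ size< k τ + s
weakStripᵇ⁻ k τ κ s eq with ∧-true {isPartitionᵇ τ} eq
... | _ , eq₁ with ∧-true {isCoreᵇ k τ} eq₁
... | _ , eq₂ with ∧-true {isPartitionᵇ κ} eq₂
... | _ , eq₃ with ∧-true {isCoreᵇ k κ} eq₃
... | cκ , eq₄ with ∧-true {horizontalᵇ τ κ} eq₄
... | hor , eq₅ = cκ , hor , ≡ᵇ≡true⇒≡ (size< k κ) (size< k τ + s) (proj₁ (∧-true eq₅))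

module _ (k : ℕ) where

  -- For any candidate strip, s = σ by size, σ ≤ e by `strip-size`, and e ≤ s because a candidate
  -- adds at most s cells per row. The forced equality σ = e leaves only the full strip.
  strips-core : ∀ {ts} → Blocks k ts → ∀ s → s ≤ k → strips k (core k 0 ts) s ≡ [ core k s ts ]
  strips-core {ts} bs s s≤k = trans
    (filter-singleton (λ κ → weakStripᵇ k τ κ s) nonzero (choices s (τ ++ [ 0 ])) (choices-Unique s (τ ++ [ 0 ]))
      (∈-choices⁺ (subst (λ z → Pointwise (Within s) z (core⁺ k s ts)) (sym (core⁺-zero k ts)) (core⁺-within k ts ≤-refl)))
      (trans (cong (λ κ → weakStripᵇ k τ κ s) nz) isStrip) only)
    (cong [_] nz)
    where
    τ = core k 0 ts
    nz : nonzero (core⁺ k s ts) ≡ core k s ts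
    nz = strip-nonzero k bs (core-strip k ts s)
    isStrip : weakStripᵇ k τ (core k s ts) s ≡ true
    isStrip = weakStripᵇ⁺ k τ (core k s ts) s (core-isPartition k bs 0) (core-isCore k bs z≤n) (core-isPartition k bs s) (core-isCore k bs s≤k)
      (horizontalᵇ⁺ τ (core k s ts) (core-mono k ts s) (core-interlace k ts s))
      (trans (size<-core k bs s≤k) (trans (sum-partition k ts s) (cong (_+ s) (sym (size<-core k bs z≤n)))))
      (#distinct-strip k bs s≤k)
    only : ∀ {y} → y ∈ choices s (τ ++ [ 0 ]) → weakStripᵇ k τ (nonzero y) s ≡ true → y ≡ core⁺ k s ts
    only {y} y∈ eq with ∈-choices⁻ (τ ++ [ 0 ]) y∈ | weakStripᵇ⁻ k τ (nonzero y) s eq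
    ... | within | isCore , hor , size
      with choices⇒Strip k ts (subst (λ z → Pointwise (Within s) z y) (core⁺-zero k ts) within)
             (λ i → subst (_≤ row τ (suc i)) (row-nonzero (core-positive k bs 0) within (suc (suc i)))
                      (horizontalᵇ⁻ τ (nonzero y) hor i))
    ... | e , κ , st , e≤s with strip-nonzero k bs st
    ... | refl with core⇒CoreRows k (strip-desc k st) isCore
    ... | μ , cr with strip-size k bs st cr
    ... | σ , sum≡ , σ≤e , tight = trans (tight (≤-antisym σ≤e (subst (e ≤_) s≡σ e≤s))) (cong (λ z → core⁺ k z ts) (≤-antisym e≤s (subst (_≤ e) (sym s≡σ) σ≤e)))
      where
      s≡σ : s ≡ σ
      s≡σ = +-cancelˡ-≡ (sum (partition k 0 ts)) s σ (trans (cong (_+ s) (sym (size<-core k bs z≤n)))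
              (trans (sym size) (trans (size<-CoreRows k (strip-desc k st) cr) sum≡)))

-- Sorted unions and P as a list of blocks

ins-↭ : ∀ x ys → ins x ys ↭ x ∷ ys
ins-↭ x []       = ↭-refl
ins-↭ x (y ∷ ys) with y <ᵇ x
... | true  = ↭-refl
... | false = ↭-trans (prep y (ins-↭ x ys)) (Perm.swap y x ↭-refl)

sortDesc-↭ : ∀ xs → sortDesc xs ↭ xs
sortDesc-↭ []       = ↭-refl
sortDesc-↭ (x ∷ xs) = ↭-trans (ins-↭ x (sortDesc xs)) (prep x (sortDesc-↭ xs))

ins-desc : ∀ x {ys} → Descending ys → Descending (ins x ys)
ins-desc x []                          = [] ∷ []
ins-desc x {y ∷ ys} (y≥ ∷ desc) with y <ᵇ x in eq
... | true  = (<⇒≤ y<x ∷ All.map (λ z≤y → ≤-trans z≤y (<⇒≤ y<x)) y≥) ∷ y≥ ∷ desc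
  where
  y<x : y < x
  y<x = ≤ᵇ≡true⇒≤ (suc y) x eq
... | false = All-resp-↭ (↭-sym (ins-↭ x ys)) (x≤y ∷ y≥) ∷ ins-desc x desc
  where
  x≤y : x ≤ y
  x≤y = ≮⇒≥ λ y<x → contradiction (trans (sym (<⇒<ᵇ≡true y<x)) eq) λ ()

sortDesc-desc : ∀ xs → Descending (sortDesc xs)
sortDesc-desc []       = []
sortDesc-desc (x ∷ xs) = ins-desc x (sortDesc-desc xs)

-- Reduces identities between unions of partitions to identities of multisets of parts.
Descending-↭⇒≡ : ∀ {xs ys} → Descending xs → Descending ys → xs ↭ ys → xs ≡ ys
Descending-↭⇒≡ {[]}     _ _ p = sym (↭-empty-inv (↭-sym p))
Descending-↭⇒≡ {x ∷ xs} {[]} _ _ p with () ← ↭-empty-inv p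
Descending-↭⇒≡ {x ∷ xs} {y ∷ ys} (x≥ ∷ dx) (y≥ ∷ dy) p
  with ≤-antisym (bound y≥ (∈-resp-↭ p (here refl))) (bound x≥ (∈-resp-↭ (↭-sym p) (here refl)))
  where
  bound : ∀ {a b zs} → All (_≤ b) zs → a ∈ b ∷ zs → a ≤ b
  bound _  (here refl) = ≤-refl
  bound b≥ (there a∈)  = All.lookup b≥ a∈
... | refl = cong (x ∷_) (Descending-↭⇒≡ dx dy (drop-∷ p))

concatMap-↭ : ∀ {A B : Set} (f : A → List B) {xs ys} → xs ↭ ys → concatMap f xs ↭ concatMap f ys
concatMap-↭ f Perm.refl          = ↭-refl
concatMap-↭ f (prep x p)        = ++⁺ˡ (f x) (concatMap-↭ f p)
concatMap-↭ f (Perm.swap x y p)      = ↭-trans (shifts (f x) (f y)) (++⁺ˡ (f y) (++⁺ˡ (f x) (concatMap-↭ f p)))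
concatMap-↭ f (Perm.trans p q)   = ↭-trans (concatMap-↭ f p) (concatMap-↭ f q)

swap-ends : ∀ (x y : ℕ) xs → x ∷ xs ++ [ y ] ↭ y ∷ xs ++ [ x ]
swap-ends x y xs = ↭-trans (prep x (↭-sym (∷↭∷ʳ y xs))) (↭-trans (Perm.swap x y ↭-refl) (prep y (∷↭∷ʳ x xs)))

module _ (k : ℕ) where

  partition-zero : ∀ {ts} → Blocks k ts → partition k 0 ts ≡ concatMap (Rect k) ts
  partition-zero []                            = refl
  partition-zero {t ∷ ts} (block _ t≤k _ bs) rewrite +-∸-assoc 1 t≤k =
    cong (λ z → t ∷ replicate (k ∸ t) t ++ z) (partition-zero bs)

  -- At each block {e ⊔ t, e ⊓ t} and {t, e} are the same multiset. Positivity of e and t keeps the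
  -- carried part from vanishing at the top.
  partition-suc : ∀ {ts} → Blocks k ts → ∀ {e} → 1 ≤ e → partition k e ts ↭ partition k 0 ts ++ [ e ]
  partition-suc []                          {suc e} 1≤e = ↭-refl
  partition-suc {t ∷ ts} (block 1≤t _ _ bs) {e}     1≤e = begin
    (e ⊔ t) ∷ R ++ partition k (e ⊓ t) ts           ↭⟨ prep (e ⊔ t) (++⁺ˡ R (partition-suc bs (⊓-glb 1≤e 1≤t))) ⟩
    (e ⊔ t) ∷ R ++ (partition k 0 ts ++ [ e ⊓ t ])  ≡⟨ cong (e ⊔ t ∷_) (++-assoc R (partition k 0 ts) _) ⟨
    (e ⊔ t) ∷ (R ++ partition k 0 ts) ++ [ e ⊓ t ]  ↭⟨ ends (≤-total e t) ⟩
    t ∷ (R ++ partition k 0 ts) ++ [ e ]            ∎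
    where
    open PermutationReasoning
    R = replicate (k ∸ t) t
    ends : (e ≤ t) ⊎ (t ≤ e) → (e ⊔ t) ∷ (R ++ partition k 0 ts) ++ [ e ⊓ t ] ↭ t ∷ (R ++ partition k 0 ts) ++ [ e ]
    ends (inj₁ e≤t) rewrite m≤n⇒m⊔n≡n e≤t | m≤n⇒m⊓n≡m e≤t = ↭-refl
    ends (inj₂ t≤e) rewrite m≥n⇒m⊔n≡m t≤e | m≥n⇒m⊓n≡n t≤e = swap-ends e t (R ++ partition k 0 ts)

  partition≤ : ∀ {b} ts e → All (_≤ b) ts → e ≤ b → All (_≤ b) (partition k e ts)
  partition≤ []       e []           e≤b = All.map (λ x≤e → ≤-trans x≤e e≤b) (top≤ k e)
  partition≤ (t ∷ ts) e (t≤b ∷ ts≤b) e≤b =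
    ⊔-lub e≤b t≤b ∷ ++⁺ (replicate⁺ (k ∸ t) t≤b) (partition≤ ts (e ⊓ t) ts≤b (≤-trans (m⊓n≤m e t) e≤b))

  partition-desc : ∀ {ts} → Blocks k ts → ∀ e → Descending (partition k e ts)
  partition-desc []                            e = top-desc k e
  partition-desc {t ∷ ts} (block _ _ ts≤t bs) e =
    All.map (λ x≤t → ≤-trans x≤t (m≤n⊔m e t)) (++⁺ (replicate⁺ (k ∸ t) ≤-refl) above) ∷
    Descending-replicate (k ∸ t) above (partition-desc bs (e ⊓ t))
    where
    above : All (_≤ t) (partition k (e ⊓ t) ts)
    above = partition≤ ts (e ⊓ t) ts≤t (m⊓n≤n e t)

  blocks : ∀ {ts} → Descending ts → All (λ t → 1 ≤ t × t ≤ k) ts → Blocks k ts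
  blocks []            []                    = []
  blocks (t≥ ∷ desc) ((1≤t , t≤k) ∷ bounds) = block 1≤t t≤k t≥ (blocks desc bounds)

  RectPow-↭ : ∀ t a → RectPow k t a ↭ concatMap (Rect k) (replicate a t)
  RectPow-↭ t zero    = ↭-refl
  RectPow-↭ t (suc a) = ↭-trans (sortDesc-↭ (Rect k t ++ RectPow k t a)) (++⁺ˡ (Rect k t) (RectPow-↭ t a))

  module _ {m : ℕ} (t a : Fin m → ℕ) where

    parts : List (Fin m) → List ℕ
    parts = concatMap (λ v → replicate (a v) (t v))

    union : List (Fin m) → List ℕ
    union = foldr (λ v acc → RectPow k (t v) (a v) ∪ₚ acc) []

    union-↭ : ∀ vs → union vs ↭ concatMap (Rect k) (parts vs)
    union-↭ []       = ↭-refl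
    union-↭ (v ∷ vs) = begin
      RectPow k (t v) (a v) ∪ₚ union vs
        ↭⟨ sortDesc-↭ (RectPow k (t v) (a v) ++ union vs) ⟩
      RectPow k (t v) (a v) ++ union vs
        ↭⟨ ↭-++⁺ (RectPow-↭ (t v) (a v)) (union-↭ vs) ⟩
      concatMap (Rect k) (replicate (a v) (t v)) ++ concatMap (Rect k) (parts vs)
        ≡⟨ concatMap-++ (Rect k) (replicate (a v) (t v)) (parts vs) ⟨
      concatMap (Rect k) (parts (v ∷ vs)) ∎
      where open PermutationReasoning

    union-desc : ∀ vs → Descending (union vs)
    union-desc []       = []
    union-desc (v ∷ vs) = sortDesc-desc (RectPow k (t v) (a v) ++ union vs)

    ∈-parts⁻ : ∀ {x} vs → x ∈ parts vs → ∃ λ v → x ≡ t v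
    ∈-parts⁻ vs x∈ with satisfied (∈-concatMap⁻ (λ v → replicate (a v) (t v)) {xs = vs} x∈)
    ... | v , x∈r = v , constant (a v) x∈r
      where
      constant : ∀ n {x y : ℕ} → x ∈ replicate n y → x ≡ y
      constant (suc n) (here eq)  = eq
      constant (suc n) (there x∈) = constant n x∈

    ∈-parts⁺ : ∀ {vs} v → 1 ≤ a v → v ∈ vs → t v ∈ parts vs
    ∈-parts⁺ v 1≤a v∈ = ∈-concatMap⁺ (λ v → replicate (a v) (t v)) (Any.map (λ { refl → first 1≤a }) v∈)
      where
      first : ∀ {n} {x : ℕ} → 1 ≤ n → x ∈ replicate n x
      first (s≤s _) = here refl

≤ᵇ-suc : ∀ {m n} → m ≢ n → (n ≤ᵇ m) ≡ (suc n ≤ᵇ m)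
≤ᵇ-suc {m} {n} m≢n with <-cmp m n
... | tri< m<n _ _ = trans (<⇒≤ᵇ≡false m<n) (sym (<⇒≤ᵇ≡false (m<n⇒m<1+n m<n)))
... | tri≈ _ eq _  = contradiction eq m≢n
... | tri> _ _ n<m = trans (≤⇒≤ᵇ≡true (<⇒≤ n<m)) (sym (≤⇒≤ᵇ≡true n<m))

-- From i to i + 1 the count loses just the v with t_v = i, and distinctness allows at most one.
α-step : ∀ m (t : Fin m → ℕ) → (∀ v w → t v ≡ t w → v ≡ w) → ∀ i → α m t i ≡ α m t (suc i) ⊎ α m t i ≡ suc (α m t (suc i))
α-step m t inj i = go (allFin m) (allFin⁺ m)
  where
  count : ℕ → List (Fin m) → ℕ
  count i vs = length (filterᵇ (λ v → i ≤ᵇ t v) vs)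
  absent : ∀ vs → All (λ v → t v ≢ i) vs → count i vs ≡ count (suc i) vs
  absent vs ne = cong length (filterᵇ-cong (All.map ≤ᵇ-suc ne))
  go : ∀ vs → Unique vs → count i vs ≡ count (suc i) vs ⊎ count i vs ≡ suc (count (suc i) vs)
  go []       _ = inj₁ refl
  go (v ∷ vs) (v∉ ∷ uniq) with t v ≟ i
  ... | yes tv≡i rewrite ≤⇒≤ᵇ≡true (≤-reflexive (sym tv≡i)) | <⇒≤ᵇ≡false {suc i} (s≤s (≤-reflexive tv≡i)) =
    inj₂ (cong suc (absent vs (All.map (λ v≢w tw≡i → v≢w (inj v _ (trans tv≡i (sym tw≡i)))) v∉)))
  ... | no tv≢i rewrite ≤ᵇ-suc tv≢i with suc i ≤ᵇ t v | go vs uniq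
  ...   | true  | inj₁ eq = inj₁ (cong suc eq)
  ...   | true  | inj₂ eq = inj₂ (cong suc eq)
  ...   | false | rec     = rec

theorem4p4 : (k m : ℕ) → 1 ≤ k → 1 ≤ m →
    (t a : Fin m → ℕ) →
    (∀ v → 1 ≤ t v × t v ≤ k) →
    (∀ v w → t v ≡ t w → v ≡ w) →
    (∀ v → 1 ≤ a v) →
    (g : Data.List.List ℕ → Poly k) → IsKkSchur k g →
    (r : ℕ) → 1 ≤ r → r ≤ k →
    g (Pfam k m t a ∪ₚ (r ∷ [])) ≈ᴾ g (Pfam k m t a) *ᴾ quotientRHS k m t r
theorem4p4 k m _ _ t a bounds inj 1≤a g kk r 1≤r r≤k =
  subst₂ (λ x y → g x ≈ᴾ g y *ᴾ quotientRHS k m t r)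
    (trans (𝔭-core k bs r≤k) (sym P∪r≡)) (trans (𝔭-core k bs z≤n) (sym P≡))
    (pieri-chain k g kk (core k 0 ts) (core-isPartition k bs 0) (core-isCore k bs z≤n) (λ s → core k s ts)
      (α m t) (α-step m t inj) (strips-core k bs)
      (λ s _ → #distinct-corners k bs m t (proj₂ ∘ bounds) inj
        (λ x∈ → ∈-parts⁻ k t a (allFin m) (∈-resp-↭ ts↭ x∈))
        (λ v → ∈-resp-↭ (↭-sym ts↭) (∈-parts⁺ k t a v (1≤a v) (∈-allFin v))) s)
      r r≤k)
  where
  -- Each t_v, repeated a_v ≥ 1 times, in descending order: the widest rectangle comes first and
  -- lies at the bottom, as `Blocks` demands.
  ts = sortDesc (parts k t a (allFin m))
  ts↭ : ts ↭ parts k t a (allFin m)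
  ts↭ = sortDesc-↭ (parts k t a (allFin m))
  in-range : ∀ {x} → x ∈ parts k t a (allFin m) → 1 ≤ x × x ≤ k
  in-range x∈ with ∈-parts⁻ k t a (allFin m) x∈
  ... | v , refl = bounds v
  bs : Blocks k ts
  bs = blocks k (sortDesc-desc (parts k t a (allFin m))) (All-resp-↭ (↭-sym ts↭) (All.tabulate in-range))
  P≡ : Pfam k m t a ≡ partition k 0 ts
  P≡ = Descending-↭⇒≡ (union-desc k t a (allFin m)) (partition-desc k bs 0)
    (↭-trans (union-↭ k t a (allFin m)) (↭-trans (concatMap-↭ (Rect k) (↭-sym ts↭)) (↭-reflexive (sym (partition-zero k bs)))))
  P∪r≡ : Pfam k m t a ∪ₚ (r ∷ []) ≡ partition k r ts
  P∪r≡ = trans (cong (_∪ₚ (r ∷ [])) P≡) (Descending-↭⇒≡ (sortDesc-desc (partition k 0 ts ++ [ r ])) (partition-desc k bs r)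
    (↭-trans (sortDesc-↭ (partition k 0 ts ++ [ r ])) (↭-sym (partition-suc k bs 1≤r))))
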